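{- Let $\mathbf{B}$ be a 2-element algebra with universe $\{0,1\}$ such that at least one of the following holds: (1) $\mathsf{MPT}_0^{\infty} \preceq \mathbf{B}$, (2) $\mathsf{MPT}_1^{\infty} \preceq \mathbf{B}$, or (3) $\mathsf{AP} \preceq \mathbf{B}$. Let $\mathbf{A} = \mathbf{B}^n$. Then the quantum circuit $\mathrm{Simon}_\phi(n)$ solves $\mathrm{HKP}(\mathbf{A})$ with probability $1 - 1/\tau$ using $\Theta(n + \lg \tau)$ iterations of the circuit.
   Context: An algebra is a set with finitely many finitary operations; similar algebras have corresponding operations of equal arities. A congruence of an algebra is an equivalence relation on its universe compatible with all operations; the kernel of a homomorphism $\phi$ is $\ker(\phi)=\{(a,b): \phi(a)=\phi(b)\}$. The clone $\mathrm{Clo}(\mathbf{B})$ of term operations of $\mathbf{B}$ is the smallest set of operations on $B$ containing the operations of $\mathbf{B}$ and all projections and closed under composition. For a set $F$ of Boolean operations, the clone generated by $F$ is the smallest clone on $\{0,1\}$ containing $F$. For a clone $\mathcal{C}$ on $\{0,1\}$ write $\mathcal{C}\preceq \mathbf{B}$ if $\mathcal{C}\subseteq \mathrm{Clo}(\mathbf{B})$. Here $\mathsf{MPT}_0^\infty$ is the clone generated by $x \vee (y\wedge z)$, $\mathsf{MPT}_1^\infty$ is the clone generated by $x\wedge(y\vee z)$, and $\mathsf{AP}$ is the clone generated by $x+y+z$ (addition modulo 2). $\mathbf{B}^n$ is the direct power with operations acting coordinatewise; its elements are identified with bit strings in $\{0,1\}^n$. The Hidden Kernel Problem $\mathrm{HKP}(\mathbf{A})$: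 given a similar algebra $\mathbf{C}$ and a homomorphism $\phi:\mathbf{A}\to\mathbf{C}$ accessible only as an oracle (black box), determine the congruence $\ker(\phi)$ (e.g. by a generating set). The circuit $\mathrm{Simon}_\phi(n)$: regard $\phi$ as a function $\{0,1\}^n\to\{0,1\}^m$ (elements of the codomain encoded as bit strings, $m\le n$ possible). Let $\widehat{\phi}$ be the unitary on $n+m$ qubits with $\widehat{\phi}(|x\rangle\otimes|y\rangle)=|x\rangle\otimes|y+\phi(x)\rangle$ ($+$ componentwise mod 2). The circuit applies $(H^{\otimes n}\otimes I_m)\,\widehat{\phi}\,(H^{\otimes n}\otimes I_m)$ to $|0^n\rangle\otimes|0^m\rangle$, where $H$ is the Hadamard gate, and then measures the first $n$ qubits; an iteration is one run of this circuit (with classical post-processing of the measurement results). -}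

module Defs where

open import Algebra.Definitions.RawSemiring using ()
open import Data.Bool.Base using (Bool; true; false; _∧_; _∨_; _xor_; if_then_else_; T)
import Data.Bool.Properties as Bool
open import Data.Fin.Base using (Fin)
open import Data.List.Base using (List; []; _∷_; cartesianProduct; cartesianProductWith; foldr)
open import Data.List.Membership.Propositional using (_∈_)
open import Data.Nat.Base as ℕ using (ℕ; zero; suc)
open import Data.Product.Base using (Σ-syntax; ∃-syntax; _×_; _,_)
import Data.Product.Properties as Product
open import Data.Rational.Base as ℚ using (ℚ; 0ℚ; 1ℚ; ½)
open import Data.Sum.Base using (_⊎_)
open import Data.Vec.Base as Vec using (Vec; []; _∷_; lookup; map; replicate; tabulate; zipWith)
import Data.Vec.Properties as Vec
open import Data.Vec.Relation.Binary.Pointwise.Inductive using (Pointwise)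
open import Function.Bundles using (_⇔_)
open import Relation.Binary.Definitions using (DecidableEquality)
open import Relation.Binary.PropositionalEquality using (_≡_; _≗_)
open import Relation.Nullary.Decidable using (does)

open Algebra.Definitions.RawSemiring ℚ.+-*-rawSemiring public using () renaming (_^_ to _^ℚ_)

------------------------------------------------------------------------
-- Algebras

record Signature : Set where
  field
    symbols : ℕ
    arity   : Fin symbols → ℕ

open Signature public

Op : Set → ℕ → Set
Op X k = Vec X k → X

-- An algebra of type σ with universe X.
Algebra : Signature → Set → Set
Algebra σ X = (s : Fin (symbols σ)) → Op X (arity σ s)

IsHom : ∀ {σ X Y} → Algebra σ X → Algebra σ Y → (X → Y) → Set
IsHom A C φ = ∀ s xs → φ (A s xs) ≡ C s (map φ xs)

_^ᴬ_ : ∀ {σ X} → Algebra σ X → (n : ℕ) → Algebra σ (Vec X n)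
(B ^ᴬ n) s xs = tabulate λ i → B s (map (λ x → lookup x i) xs)

data Cg {σ X} (A : Algebra σ X) (G : List (X × X)) : X → X → Set where
  base  : ∀ {a b} → (a , b) ∈ G → Cg A G a b
  refl  : ∀ {a} → Cg A G a a
  sym   : ∀ {a b} → Cg A G a b → Cg A G b a
  trans : ∀ {a b c} → Cg A G a b → Cg A G b c → Cg A G a c
  cong  : ∀ s {as bs} → Pointwise (Cg A G) as bs → Cg A G (A s as) (A s bs)

GeneratesKernel : ∀ {σ X Y} → Algebra σ X → List (X × X) → (X → Y) → Set
GeneratesKernel A G φ = ∀ a b → Cg A G a b ⇔ φ a ≡ φ b

------------------------------------------------------------------------
-- Clones

OpSet : Set → Set₁
OpSet X = ∀ k → Op X k → Set

-- Operations are functions, so without function extensionality closure under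
-- pointwise equality (`ext`) has to be demanded explicitly.
data Clone {X} (F : OpSet X) : OpSet X where
  gen  : ∀ {k f} → F k f → Clone F k f
  proj : ∀ {k} (i : Fin k) → Clone F k (λ xs → lookup xs i)
  comp : ∀ {k l f} {gs : Fin k → Op X l} →
         Clone F k f → (∀ i → Clone F l (gs i)) →
         Clone F l (λ xs → f (tabulate λ i → gs i xs))
  ext  : ∀ {k f g} → f ≗ g → Clone F k f → Clone F k g

data OperationsOf {σ X} (B : Algebra σ X) : OpSet X where
  operation : ∀ s → OperationsOf B (arity σ s) (B s)

data Only {X k} (f : Op X k) : OpSet X where
  only : Only f k f

Clo : ∀ {σ X} → Algebra σ X → OpSet X
Clo B = Clone (OperationsOf B)

_≼_ : ∀ {σ} → OpSet Bool → Algebra σ Bool → Set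
𝒞 ≼ B = ∀ k f → 𝒞 k f → Clo B k f

x∨⟨y∧z⟩ x∧⟨y∨z⟩ x+y+z : Op Bool 3
x∨⟨y∧z⟩ (x ∷ y ∷ z ∷ []) = x ∨ (y ∧ z)
x∧⟨y∨z⟩ (x ∷ y ∷ z ∷ []) = x ∧ (y ∨ z)
x+y+z   (x ∷ y ∷ z ∷ []) = x xor (y xor z)

MPT₀∞ MPT₁∞ AP : OpSet Bool
MPT₀∞ = Clone (Only x∨⟨y∧z⟩)
MPT₁∞ = Clone (Only x∧⟨y∨z⟩)
AP    = Clone (Only x+y+z)

------------------------------------------------------------------------
-- Amplitudes

-- Every amplitude in the circuit lies in the real field ℚ(√2) ⊆ ℂ, so complex
-- conjugation is trivial and ∣α∣² is α * α.
-- The pair (a , b) stands for a + b√2.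
record ℚ√2 : Set where
  constructor _+√2·_
  field
    rat irr : ℚ

infix  8 _+√2·_
infixl 6 _+_ _-_
infixl 7 _*_
infix  4 _≤_

_+_ _-_ _*_ : ℚ√2 → ℚ√2 → ℚ√2
(a +√2· b) + (c +√2· d) = (a ℚ.+ c) +√2· (b ℚ.+ d)
(a +√2· b) - (c +√2· d) = (a ℚ.- c) +√2· (b ℚ.- d)
(a +√2· b) * (c +√2· d) =
  (a ℚ.* c ℚ.+ (1ℚ ℚ.+ 1ℚ) ℚ.* (b ℚ.* d)) +√2· (a ℚ.* d ℚ.+ b ℚ.* c)

fromℚ : ℚ → ℚ√2
fromℚ a = a +√2· 0ℚ

0# 1# 1/√2 -1/√2 : ℚ√2
0#    = fromℚ 0ℚ
1#    = fromℚ 1ℚ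
1/√2  = 0ℚ +√2· ½
-1/√2 = 0ℚ +√2· (ℚ.- ½)

-- The order inherited from ℝ: if a and b are not both nonnegative, then
-- 0 ≤ a + b√2 is decided by comparing a² with 2b².
NonNeg : ℚ√2 → Set
NonNeg (a +√2· b) =
    (0ℚ ℚ.≤ a × 0ℚ ℚ.≤ b)
  ⊎ (0ℚ ℚ.≤ a × (1ℚ ℚ.+ 1ℚ) ℚ.* (b ℚ.* b) ℚ.≤ a ℚ.* a)
  ⊎ (0ℚ ℚ.≤ b × a ℚ.* a ℚ.≤ (1ℚ ℚ.+ 1ℚ) ℚ.* (b ℚ.* b))

_≤_ : ℚ√2 → ℚ√2 → Set
p ≤ q = NonNeg (q - p)

∑ : ∀ {I : Set} → List I → (I → ℚ√2) → ℚ√2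
∑ is f = foldr (λ i acc → f i + acc) 0# is

∏ : ∀ {I : Set} {k} → Vec I k → (I → ℚ√2) → ℚ√2
∏ is f = Vec.foldr′ (λ i acc → f i * acc) 1# is

------------------------------------------------------------------------
-- Bit strings

Bits : ℕ → Set
Bits n = Vec Bool n

0ⁿ : ∀ {n} → Bits n
0ⁿ = replicate _ false

_⊕_ : ∀ {n} → Bits n → Bits n → Bits n
_⊕_ = zipWith _xor_

allVecs : ∀ {I : Set} → List I → (k : ℕ) → List (Vec I k)
allVecs is zero    = [] ∷ []
allVecs is (suc k) = cartesianProductWith _∷_ is (allVecs is k)

allBits : (n : ℕ) → List (Bits n)
allBits = allVecs (false ∷ true ∷ [])

-- Labels of the computational basis |x⟩⊗|y⟩ of n+m qubits.
Basis : ℕ → ℕ → Set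
Basis n m = Bits n × Bits m

allBasis : ∀ n m → List (Basis n m)
allBasis n m = cartesianProduct (allBits n) (allBits m)

_≟ᵇ_ : ∀ {n} → DecidableEquality (Bits n)
_≟ᵇ_ = Vec.≡-dec Bool._≟_

_≟ᵇᵇ_ : ∀ {n m} → DecidableEquality (Basis n m)
_≟ᵇᵇ_ = Product.≡-dec _≟ᵇ_ _≟ᵇ_

------------------------------------------------------------------------
-- The circuit

Matrix : Set → Set
Matrix I = I → I → ℚ√2          -- M i j = ⟨i|M|j⟩

State : ℕ → ℕ → Set
State n m = Basis n m → ℚ√2

δ : ∀ {I : Set} → DecidableEquality I → Matrix I
δ _≟_ i j = if does (i ≟ j) then 1# else 0#

∣_⟩ : ∀ {n m} → Basis n m → State n m
∣ b ⟩ i = δ _≟ᵇᵇ_ i b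

_·_ : ∀ {n m} → Matrix (Basis n m) → State n m → State n m
(M · ψ) i = ∑ (allBasis _ _) λ j → M i j * ψ j

_⊗_ : ∀ {I J : Set} → Matrix I → Matrix J → Matrix (I × J)
(M ⊗ N) (i , i′) (j , j′) = M i j * N i′ j′

H : Matrix Bool
H true true = -1/√2
H _    _    = 1/√2

H^⊗ : ∀ n → Matrix (Bits n)
H^⊗ zero    []       []       = 1#
H^⊗ (suc n) (x ∷ xs) (y ∷ ys) = H x y * H^⊗ n xs ys

I : ∀ m → Matrix (Bits m)
I m = δ _≟ᵇ_

oracle : ∀ {n m} → (Bits n → Bits m) → Matrix (Basis n m)
oracle f i (x , y) = δ _≟ᵇᵇ_ i (x , y ⊕ f x)

simonState : ∀ {n m} → (Bits n → Bits m) → State n m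
simonState {n} {m} f =
  (H^⊗ n ⊗ I m) · (oracle f · ((H^⊗ n ⊗ I m) · ∣ 0ⁿ , 0ⁿ ⟩))

-- Born rule for measuring the first n qubits.
measureFirst : ∀ {n m} → State n m → Bits n → ℚ√2
measureFirst {n} {m} ψ x = ∑ (allBits m) λ y → ψ (x , y) * ψ (x , y)

simon : ∀ {n m} → (Bits n → Bits m) → Bits n → ℚ√2
simon f = measureFirst (simonState f)

-- The results of k independent runs satisfy P with probability at least p.
-- P need not come with a decision procedure, so the probability of P is
-- bounded below by that of a decidable event E contained in it; the sample
-- space being finite, classically this is no restriction.
SimonProb≥ : ∀ {n m} → (Bits n → Bits m) → (k : ℕ) → ℚ → (Vec (Bits n) k → Set) → Set
SimonProb≥ {n} f k p P =
  Σ[ E ∈ (Vec (Bits n) k → Bool) ]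
    (∀ ω → T (E ω) → P ω) ×
    fromℚ p ≤ ∑ (allVecs (allBits n) k) λ ω → if E ω then ∏ ω (simon f) else 0#

------------------------------------------------------------------------
-- Solving the hidden kernel problem

-- Classical post-processing of k measurement results into a finite set of
-- pairs, meant to generate the hidden kernel.
PostProcessing : ℕ → ℕ → Set
PostProcessing n k = Vec (Bits n) k → List (Bits n × Bits n)

-- The post-processing is fixed before the hidden homomorphism φ, its codomain C
-- and the encoding of elements of C as bit strings.  Only the values of φ have to
-- be encoded faithfully.
SolvesHKP : ∀ {σ n} → Algebra σ (Bits n) → (k : ℕ) → PostProcessing n k → ℚ → Set₁
SolvesHKP {σ} {n} A k post p =
  ∀ {Y : Set} (C : Algebra σ Y) (φ : Bits n → Y) → IsHom A C φ →
  ∀ {m} (encode : Y → Bits m) → (∀ a b → encode (φ a) ≡ encode (φ b) → φ a ≡ φ b) →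
  SimonProb≥ (λ x → encode (φ x)) k p λ ω → GeneratesKernel A (post ω) φ

-- g(n, τ) = Θ(n + lg τ), uniformly in n ≥ 1 and τ ≥ 1.  Since n + lg τ = lg (2ⁿ τ),
-- the conditions g ≤ c (n + lg τ) and n + lg τ ≤ d g become, after applying the
-- increasing map t ↦ 2ᵗ, exact inequalities between rationals.
Θ[n+lgτ] : (ℕ → ℚ → ℕ) → Set
Θ[n+lgτ] g = ∃[ c ] ∃[ d ] ∀ n τ → 1 ℕ.≤ n → 1ℚ ℚ.≤ τ →
    (2ℚ ^ℚ g n τ) ℚ.≤ ((2ℚ ^ℚ n) ℚ.* τ) ^ℚ c
  × (2ℚ ^ℚ n) ℚ.* τ ℚ.≤ (2ℚ ^ℚ g n τ) ^ℚ d
  where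
  2ℚ : ℚ
  2ℚ = 1ℚ ℚ.+ 1ℚ

{-# OPTIONS --safe #-}
-- Each of the three clones yields, with constants from the algebra, either the lattice operations
-- or x + y + z, so every congruence of a power Bⁿ is invariant under the translations of (ℤ/2)ⁿ:
-- it is the coset partition of a subgroup V.  This applies to the kernel of φ and to every Cg G,
-- so the kernel is generated by the pairs (u , 0) with u ∈ V.  For the outcome w of one run, the
-- expectation of (-1)^(w·u) is 1 if u ∈ V and 0 otherwise, hence w·u = 0 with probability 1 or ½.
-- By the union bound, in k runs some u is misjudged with probability at most 2ⁿ / 2ᵏ, which is
-- at most 1/τ for k = n + ⌈lg τ⌉.
module Submission where

open import Defs hiding (_-_; ∑; ∏; base; refl; sym; trans; cong)
  renaming (_+_ to _+√_; _*_ to _*√_; _≤_ to _≤√_; 0# to 0√; 1# to 1√)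
open import Algebra.Bundles using (CommutativeRing; CommutativeSemiring)
import Algebra.Definitions.RawSemiring
open import Algebra.Lattice.Bundles using (BooleanAlgebra)
import Algebra.Lattice.Properties.BooleanAlgebra
import Algebra.Properties.AbelianGroup
import Algebra.Properties.CommutativeSemigroup
import Algebra.Properties.CommutativeSemiring.Exp
open import Algebra.Structures.Biased using (IsCommutativeSemiringˡ)
open import Data.Bool.Base using (Bool; true; false; T; not; _∧_; _∨_; _xor_; if_then_else_)
open import Data.Bool.ListAction using (all)
import Data.Bool.Properties as Bool
open import Data.Fin.Subset using (_∩_; _∪_; ∁)
open import Data.Fin.Subset.Properties using (∪-∩-booleanAlgebra)
open import Data.Integer.Base as ℤ using (-[1+_]) renaming (+_ to pos)
import Data.Integer.Properties as ℤ
open import Data.List.Base as List using (List; []; _∷_; _++_; filterᵇ)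
open import Data.List.Membership.Propositional using (_∈_)
open import Data.List.Membership.Propositional.Properties
  using (∈-cartesianProductWith⁺; ∈-filter⁺; ∈-filter⁻; ∈-map⁺; ∈-map⁻)
import Data.List.Relation.Unary.All as All
import Data.List.Relation.Unary.All.Properties as All
open import Data.List.Relation.Unary.Any using (here; there)
open import Data.Nat.Base as ℕ using (ℕ; zero; suc)
open import Data.Nat.Coprimality as Coprimality using (1-coprimeTo)
import Data.Nat.Properties as ℕ
open import Data.Product.Base using (Σ-syntax; _×_; _,_; proj₁; proj₂)
open import Data.Rational.Base as ℚ using (ℚ; mkℚ; 0ℚ; 1ℚ; ½; NonZero; 1/_)
import Data.Rational.Properties as ℚ
open import Data.Rational.Solver using (module +-*-Solver)
open import Data.Sum.Base using (_⊎_; inj₁; inj₂)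
open import Data.Unit.Base using (tt)
open import Data.Vec.Base as Vec using (Vec; []; _∷_; lookup; map; replicate; tabulate; zipWith)
open import Data.Vec.Properties
  using (lookup-map; lookup∘tabulate; tabulate-∘; tabulate-cong; tabulate∘lookup;
         zipWith-assoc; zipWith-comm; zipWith-identityˡ; zipWith-identityʳ)
open import Data.Vec.Relation.Binary.Pointwise.Inductive as Pointwise using (Pointwise; []; _∷_)
open import Function.Bundles using (mk⇔)
open import Level using (0ℓ)
import Relation.Binary.Reasoning.Setoid
open import Relation.Binary.PropositionalEquality as ≡ using (_≡_; subst; subst₂)
open import Relation.Binary.Structures using (IsEquivalence)
open import Relation.Nullary.Decidable using (Dec; yes; no; does; does-⇔; dec-true)

-- In the two lattice cases addition need not be a term operation, since complement may be missing.
-- Translation invariance survives because an equivalence on `{0,1}ⁿ` that respects joins and meets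
-- with arbitrary elements respects complements automatically. Constants come for free: a reflexive
-- compatible relation allows any element in the remaining arguments of an operation. The two uses
-- of invariance differ. For the kernel it supplies Simon's promise; for `Cg G` it lets a single
-- generator `(a ⊕ b , 0ⁿ)` produce the pair `(a , b)`. The subgroup V enters only through the
-- predicate `f u ≡ f 0ⁿ`, and every `u` is tested separately against the outcomes. The union bound
-- over all 2ⁿ vectors is what costs the summand `n` in the number of runs. The two Hadamard layers
-- contribute `(1/√2)ⁿ` each, together `½ⁿ`, so all final amplitudes are rational and the estimates
-- take place in ℚ.

private
  variable
    σ : Signature
    X Y Z : Set
    k m n : ℕ

-- Congruences of powers

record IsCongruence (A : Algebra σ X) (_∼_ : X → X → Set) : Set where
  field
    isEquivalence : IsEquivalence _∼_
    compatible    : ∀ s {as bs} → Pointwise _∼_ as bs → A s as ∼ A s bs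
  open IsEquivalence isEquivalence public

Cg-isCongruence : ∀ (A : Algebra σ X) G → IsCongruence A (Cg A G)
Cg-isCongruence A G = record
  { isEquivalence = record { refl = Cg.refl ; sym = Cg.sym ; trans = Cg.trans }
  ; compatible    = Cg.cong
  }

ker-isCongruence : ∀ {A : Algebra σ X} {C : Algebra σ Y} {φ} → IsHom A C φ →
                   IsCongruence A (λ a b → φ a ≡ φ b)
ker-isCongruence {A = A} {C} {φ} hom = record
  { isEquivalence = record { refl = ≡.refl ; sym = ≡.sym ; trans = ≡.trans }
  ; compatible    = λ s {as} {bs} as∼bs →
      ≡.trans (hom s as) (≡.trans (≡.cong (C s) (map-φ as∼bs)) (≡.sym (hom s bs)))
  }
  where
  map-φ : ∀ {k} {as bs : Vec _ k} → Pointwise (λ a b → φ a ≡ φ b) as bs → map φ as ≡ map φ bs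
  map-φ []       = ≡.refl
  map-φ (e ∷ es) = ≡.cong₂ _∷_ e (map-φ es)

Cg-least : ∀ {A : Algebra σ X} {G} {_∼_} → IsCongruence A _∼_ →
           (∀ {a b} → (a , b) ∈ G → a ∼ b) → ∀ {a b} → Cg A G a b → a ∼ b
Cg-least {A = A} {G} {_∼_} isCong G⊆∼ = go
  where
  module ∼ = IsCongruence isCong
  go  : ∀ {a b} → Cg A G a b → a ∼ b
  go* : ∀ {k} {as bs : Vec _ k} → Pointwise (Cg A G) as bs → Pointwise _∼_ as bs
  go (Cg.base p)    = G⊆∼ p
  go Cg.refl        = ∼.refl
  go (Cg.sym p)     = ∼.sym (go p)
  go (Cg.trans p q) = ∼.trans (go p) (go q)
  go (Cg.cong s ps) = ∼.compatible s (go* ps)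
  go* []       = []
  go* (p ∷ ps) = go p ∷ go* ps

-- Shaped so that `(B ^ᴬ n) s` is `B s ^ᵒ n` by definition; the generator case of `Clo-compatible`
-- is then compatibility itself.
_^ᵒ_ : ∀ {k} → Op X k → ∀ n → Op (Vec X n) k
(f ^ᵒ n) xs = tabulate λ i → f (map (λ x → lookup x i) xs)

module _ {B : Algebra σ X} {_∼_ : Vec X n → Vec X n → Set} (isCong : IsCongruence (B ^ᴬ n) _∼_) where
  open IsCongruence isCong

  -- Induction on the clone: coordinatewise extension commutes with projections and with
  -- composition, so compatibility passes from the basic operations to all term operations.
  Clo-compatible : ∀ {k f} → Clo B k f → ∀ {as bs} → Pointwise _∼_ as bs →
                   (f ^ᵒ n) as ∼ (f ^ᵒ n) bs
  Clo-compatible (gen (operation s)) as∼bs = compatible s as∼bs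
  Clo-compatible (proj i) {as} {bs} as∼bs =
    subst₂ _∼_ (≡.sym (proj-^ᵒ as)) (≡.sym (proj-^ᵒ bs)) (Pointwise.lookup as∼bs i)
    where
    proj-^ᵒ : ∀ xs → ((λ xs → lookup xs i) ^ᵒ n) xs ≡ lookup xs i
    proj-^ᵒ xs = ≡.trans (tabulate-cong λ j → lookup-map i (λ x → lookup x j) xs)
                         (tabulate∘lookup (lookup xs i))
  Clo-compatible (comp {f = f} {gs} f∈ gs∈) {as} {bs} as∼bs =
    subst₂ _∼_ (≡.sym (comp-^ᵒ as)) (≡.sym (comp-^ᵒ bs))
      (Clo-compatible f∈ (Pointwise.tabulate⁺ λ j → Clo-compatible (gs∈ j) as∼bs))
    where
    comp-^ᵒ : ∀ xs → ((λ xs → f (tabulate λ j → gs j xs)) ^ᵒ n) xs ≡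
                     (f ^ᵒ n) (tabulate λ j → (gs j ^ᵒ n) xs)
    comp-^ᵒ xs = tabulate-cong λ i → ≡.cong f (≡.trans
      (tabulate-cong λ j → ≡.sym (lookup∘tabulate _ i))
      (tabulate-∘ (λ x → lookup x i) (λ j → (gs j ^ᵒ n) xs)))
  Clo-compatible (ext f≗g f∈) {as} {bs} as∼bs =
    subst₂ _∼_ (tabulate-cong λ i → f≗g _) (tabulate-cong λ i → f≗g _) (Clo-compatible f∈ as∼bs)

-- Lattice congruences of Boolean algebras

module _ {c ℓ r} (𝔹 : BooleanAlgebra c ℓ) {_~_ : BooleanAlgebra.Carrier 𝔹 → BooleanAlgebra.Carrier 𝔹 → Set r} where
  open BooleanAlgebra 𝔹 renaming (_∨_ to _⊔_; _∧_ to _⊓_; ¬_ to ∼_)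

  module LatticeCongruence
    (isEquivalence : IsEquivalence _~_)
    (≈⇒~ : ∀ {x y} → x ≈ y → x ~ y)
    (⊔-compat : ∀ z {x y} → x ~ y → (x ⊔ z) ~ (y ⊔ z))
    (⊓-compat : ∀ z {x y} → x ~ y → (x ⊓ z) ~ (y ⊓ z))
    where
    private module ~ = IsEquivalence isEquivalence
    open Algebra.Lattice.Properties.BooleanAlgebra 𝔹
    open Relation.Binary.Reasoning.Setoid setoid

    -- Start from ∼ x = (y ⊔ ∼ y) ⊓ ∼ x and replace the first y by x.
    ∼-below : ∀ {x y} → x ~ y → (∼ x) ~ ((∼ x) ⊓ (∼ y))
    ∼-below {x} {y} x~y = ~.trans (≈⇒~ below) (~.trans step (≈⇒~ above))
      where
      step : ((y ⊔ (∼ y)) ⊓ (∼ x)) ~ ((x ⊔ (∼ y)) ⊓ (∼ x))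
      step = ⊓-compat _ (⊔-compat _ (~.sym x~y))
      below : (∼ x) ≈ ((y ⊔ (∼ y)) ⊓ (∼ x))
      below = sym (trans (∧-congʳ (∨-complementʳ y)) (∧-identityˡ _))
      above : ((x ⊔ (∼ y)) ⊓ (∼ x)) ≈ ((∼ x) ⊓ (∼ y))
      above = begin
        (x ⊔ (∼ y)) ⊓ (∼ x)              ≈⟨ ∧-distribʳ-∨ _ _ _ ⟩
        (x ⊓ (∼ x)) ⊔ ((∼ y) ⊓ (∼ x))    ≈⟨ ∨-cong (∧-complementʳ x) (∧-comm _ _) ⟩
        ⊥ ⊔ ((∼ x) ⊓ (∼ y))              ≈⟨ ∨-identityˡ _ ⟩
        (∼ x) ⊓ (∼ y)                    ∎

    -- By `∼-below`, used in both directions, the two complements are related to the same element,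
    -- their meet.
    ∼-compat : ∀ {x y} → x ~ y → (∼ x) ~ (∼ y)
    ∼-compat x~y = ~.trans (∼-below x~y)
      (~.trans (≈⇒~ (∧-comm _ _)) (~.sym (∼-below (~.sym x~y))))

    ⊔-compat₂ : ∀ {w x y z} → w ~ x → y ~ z → (w ⊔ y) ~ (x ⊔ z)
    ⊔-compat₂ w~x y~z = ~.trans (⊔-compat _ w~x)
      (~.trans (≈⇒~ (∨-comm _ _)) (~.trans (⊔-compat _ y~z) (≈⇒~ (∨-comm _ _))))

    xor-compat : ∀ z {x y} → x ~ y → ((x ⊓ (∼ z)) ⊔ ((∼ x) ⊓ z)) ~ ((y ⊓ (∼ z)) ⊔ ((∼ y) ⊓ z))
    xor-compat z x~y = ⊔-compat₂ (⊓-compat _ x~y) (⊓-compat _ (∼-compat x~y))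

-- Translation invariance of congruences

TranslationInvariant : (Bits n → Bits n → Set) → Set
TranslationInvariant _∼_ = ∀ c {a b} → a ∼ b → (a ⊕ c) ∼ (b ⊕ c)

⊕-normalForm : ∀ (a c : Bits n) → a ⊕ c ≡ (a ∩ ∁ c) ∪ (∁ a ∩ c)
⊕-normalForm []       []       = ≡.refl
⊕-normalForm (a ∷ as) (c ∷ cs) = ≡.cong₂ _∷_ (bit a c) (⊕-normalForm as cs)
  where
  bit : ∀ a c → a xor c ≡ (a ∧ not c) ∨ (not a ∧ c)
  bit false false = ≡.refl
  bit false true  = ≡.refl
  bit true  false = ≡.refl
  bit true  true  = ≡.refl

module _ {_∼_ : Bits n → Bits n → Set} (isEquivalence : IsEquivalence _∼_) where
  private module ∼ = IsEquivalence isEquivalence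

  lattice⇒translationInvariant : (∀ c {a b} → a ∼ b → (a ∪ c) ∼ (b ∪ c)) →
                                 (∀ c {a b} → a ∼ b → (a ∩ c) ∼ (b ∩ c)) →
                                 TranslationInvariant _∼_
  lattice⇒translationInvariant ∪-compat ∩-compat c {a} {b} a∼b =
    subst₂ _∼_ (≡.sym (⊕-normalForm a c)) (≡.sym (⊕-normalForm b c))
      (LatticeCongruence.xor-compat (∪-∩-booleanAlgebra _) isEquivalence ∼.reflexive
         ∪-compat ∩-compat c a∼b)

^ᵒ-zipWith : ∀ (f : Op Bool 3) (g : Bool → Bool → Bool) d →
             (∀ x y → f (x ∷ y ∷ d ∷ []) ≡ g x y) →
             ∀ (a c : Bits n) → (f ^ᵒ n) (a ∷ c ∷ replicate n d ∷ []) ≡ zipWith g a c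
^ᵒ-zipWith f g d h []       []       = ≡.refl
^ᵒ-zipWith f g d h (a ∷ as) (c ∷ cs) = ≡.cong₂ _∷_ (h a c) (^ᵒ-zipWith f g d h as cs)

^ᵒ-zipWith′ : ∀ (f : Op Bool 3) (g : Bool → Bool → Bool) d →
             (∀ x y → f (d ∷ x ∷ y ∷ []) ≡ g x y) →
             ∀ (a c : Bits n) → (f ^ᵒ n) (replicate n d ∷ a ∷ c ∷ []) ≡ zipWith g a c
^ᵒ-zipWith′ f g d h []       []       = ≡.refl
^ᵒ-zipWith′ f g d h (a ∷ as) (c ∷ cs) = ≡.cong₂ _∷_ (h a c) (^ᵒ-zipWith′ f g d h as cs)

module _ {B : Algebra σ Bool} {_∼_ : Bits n → Bits n → Set} (isCong : IsCongruence (B ^ᴬ n) _∼_) where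
  open IsCongruence isCong

  private
    -- Reflexivity fills the other two arguments with the parameter `c` and the constant vector of
    -- `d`, so neither has to be the value of a term.
    binary : ∀ f → Clo B 3 f → ∀ g d → (∀ x y → f (x ∷ y ∷ d ∷ []) ≡ g x y) →
             ∀ c {a b} → a ∼ b → zipWith g a c ∼ zipWith g b c
    binary f f∈ g d h c {a} {b} a∼b =
      subst₂ _∼_ (^ᵒ-zipWith f g d h a c) (^ᵒ-zipWith f g d h b c)
        (Clo-compatible isCong f∈ {a ∷ c ∷ replicate n d ∷ []} {b ∷ c ∷ replicate n d ∷ []} (a∼b ∷ refl ∷ refl ∷ []))

    binary′ : ∀ f → Clo B 3 f → ∀ g d → (∀ x y → f (d ∷ x ∷ y ∷ []) ≡ g x y) →
             ∀ c {a b} → a ∼ b → zipWith g a c ∼ zipWith g b c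
    binary′ f f∈ g d h c {a} {b} a∼b =
      subst₂ _∼_ (^ᵒ-zipWith′ f g d h a c) (^ᵒ-zipWith′ f g d h b c)
        (Clo-compatible isCong f∈ {replicate n d ∷ a ∷ c ∷ []} {replicate n d ∷ b ∷ c ∷ []} (refl ∷ a∼b ∷ refl ∷ []))

  congruence⇒translationInvariant : (MPT₀∞ ≼ B) ⊎ (MPT₁∞ ≼ B) ⊎ (AP ≼ B) →
                                    TranslationInvariant _∼_
  congruence⇒translationInvariant (inj₁ MPT₀∞≼B) =
    -- In `x ∨ (y ∧ z)`, setting `z` to 1 gives the join and setting `x` to 0 the meet. The next
    -- case is dual: in `x ∧ (y ∨ z)`, `x = 1` gives the join and `z = 0` the meet.
    lattice⇒translationInvariant isEquivalence
      (binary _ m∈ _∨_ true λ x y → ≡.cong (x ∨_) (Bool.∧-identityʳ y))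
      (binary′ _ m∈ _∧_ false λ x y → ≡.refl)
    where m∈ = MPT₀∞≼B 3 x∨⟨y∧z⟩ (gen only)
  congruence⇒translationInvariant (inj₂ (inj₁ MPT₁∞≼B)) =
    lattice⇒translationInvariant isEquivalence
      (binary′ _ m∈ _∨_ true λ x y → ≡.refl)
      (binary _ m∈ _∧_ false λ x y → ≡.cong (x ∧_) (Bool.∨-identityʳ y))
    where m∈ = MPT₁∞≼B 3 x∧⟨y∨z⟩ (gen only)
  congruence⇒translationInvariant (inj₂ (inj₂ AP≼B)) =
    binary _ (AP≼B 3 x+y+z (gen only)) _xor_ false λ x y → ≡.cong (x xor_) (Bool.xor-identityʳ y)

-- Finite sums

-- Generic because the sums occur over both `ℚ√2` and `ℚ`. `∑` and `∏` are the same folds as in the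
-- circuit, so over `ℚ√2` they agree with it by definition.
module FiniteSums {c ℓ} (R : CommutativeSemiring c ℓ) where
  open CommutativeSemiring R
  open Algebra.Definitions.RawSemiring rawSemiring using (_^_)
  open Relation.Binary.Reasoning.Setoid setoid
  private
    module + = Algebra.Properties.CommutativeSemigroup +-commutativeSemigroup
    module * = Algebra.Properties.CommutativeSemigroup *-commutativeSemigroup

  ∑ : List X → (X → Carrier) → Carrier
  ∑ is f = List.foldr (λ i acc → f i + acc) 0# is

  ∏ : Vec X n → (X → Carrier) → Carrier
  ∏ is f = Vec.foldr′ (λ i acc → f i * acc) 1# is

  𝟙[_] : Bool → Carrier
  𝟙[ b ] = if b then 1# else 0#

  𝟙-∧ : ∀ a b → 𝟙[ a ∧ b ] ≈ 𝟙[ a ] * 𝟙[ b ]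
  𝟙-∧ true  b = sym (*-identityˡ _)
  𝟙-∧ false b = sym (zeroˡ _)

  ∑-cong : ∀ (is : List X) {f g} → (∀ i → f i ≈ g i) → ∑ is f ≈ ∑ is g
  ∑-cong []       h = refl
  ∑-cong (i ∷ is) h = +-cong (h i) (∑-cong is h)

  ∑-zero : ∀ (is : List X) → ∑ is (λ _ → 0#) ≈ 0#
  ∑-zero []       = refl
  ∑-zero (i ∷ is) = trans (+-identityˡ _) (∑-zero is)

  ∑-distrib-+ : ∀ (is : List X) f g → ∑ is (λ i → f i + g i) ≈ ∑ is f + ∑ is g
  ∑-distrib-+ []       f g = sym (+-identityˡ 0#)
  ∑-distrib-+ (i ∷ is) f g = trans (+-congˡ (∑-distrib-+ is f g)) (+.interchange _ _ _ _)

  *-distribˡ-∑ : ∀ a (is : List X) f → a * ∑ is f ≈ ∑ is (λ i → a * f i)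
  *-distribˡ-∑ a []       f = zeroʳ a
  *-distribˡ-∑ a (i ∷ is) f = trans (distribˡ a _ _) (+-congˡ (*-distribˡ-∑ a is f))

  *-distribʳ-∑ : ∀ a (is : List X) f → ∑ is f * a ≈ ∑ is (λ i → f i * a)
  *-distribʳ-∑ a is f =
    trans (*-comm _ a) (trans (*-distribˡ-∑ a is f) (∑-cong is λ i → *-comm a (f i)))

  ∑-*-∑ : ∀ (is : List X) (js : List Y) f g →
          ∑ is f * ∑ js g ≈ ∑ is λ i → ∑ js λ j → f i * g j
  ∑-*-∑ is js f g =
    trans (*-distribʳ-∑ _ is f) (∑-cong is λ i → *-distribˡ-∑ (f i) js g)

  ∑-comm : ∀ (is : List X) (js : List Y) (f : X → Y → Carrier) →
           ∑ is (λ i → ∑ js λ j → f i j) ≈ ∑ js λ j → ∑ is λ i → f i j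
  ∑-comm []       js f = sym (∑-zero js)
  ∑-comm (i ∷ is) js f = trans (+-congˡ (∑-comm is js f)) (sym (∑-distrib-+ js _ _))

  ∑-++ : ∀ (is js : List X) f → ∑ (is ++ js) f ≈ ∑ is f + ∑ js f
  ∑-++ []       js f = sym (+-identityˡ _)
  ∑-++ (i ∷ is) js f = trans (+-congˡ (∑-++ is js f)) (sym (+-assoc _ _ _))

  ∑-map : ∀ (h : X → Y) is f → ∑ (List.map h is) f ≈ ∑ is (λ i → f (h i))
  ∑-map h []       f = refl
  ∑-map h (i ∷ is) f = +-congˡ (∑-map h is f)

  ∑-cartesianProductWith : ∀ (h : X → Y → Z) is js f →
    ∑ (List.cartesianProductWith h is js) f ≈ ∑ is λ i → ∑ js λ j → f (h i j)
  ∑-cartesianProductWith h []       js f = refl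
  ∑-cartesianProductWith h (i ∷ is) js f =
    trans (∑-++ (List.map (h i) js) _ f)
          (+-cong (∑-map (h i) js f) (∑-cartesianProductWith h is js f))

  -- Independence of the runs: the mass of all `k`-tuples factors, coordinate by coordinate.
  ∑-∏ : ∀ (is : List X) k g → ∑ (allVecs is k) (λ v → ∏ v g) ≈ ∑ is g ^ k
  ∑-∏ is zero    g = +-identityʳ 1#
  ∑-∏ is (suc k) g = begin
    ∑ (allVecs is (suc k)) (λ v → ∏ v g)             ≈⟨ ∑-cartesianProductWith _∷_ is _ _ ⟩
    (∑ is λ i → ∑ (allVecs is k) λ v → g i * ∏ v g)  ≈⟨ ∑-*-∑ is (allVecs is k) g (λ v → ∏ v g) ⟨
    ∑ is g * ∑ (allVecs is k) (λ v → ∏ v g)          ≈⟨ *-congˡ (∑-∏ is k g) ⟩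
    ∑ is g * ∑ is g ^ k                              ∎

  ∏-cong : ∀ (v : Vec X n) {f g} → (∀ i → f i ≈ g i) → ∏ v f ≈ ∏ v g
  ∏-cong []      h = refl
  ∏-cong (i ∷ v) h = *-cong (h i) (∏-cong v h)

  ∏-distrib-* : ∀ (v : Vec X n) f g → ∏ v (λ i → f i * g i) ≈ ∏ v f * ∏ v g
  ∏-distrib-* []      f g = sym (*-identityˡ 1#)
  ∏-distrib-* (i ∷ v) f g = trans (*-congˡ (∏-distrib-* v f g)) (*.interchange _ _ _ _)

  ∑-allBits-suc : ∀ n f →
    ∑ (allBits (suc n)) f ≈ ∑ (allBits n) (λ v → f (false ∷ v)) + ∑ (allBits n) (λ v → f (true ∷ v))
  ∑-allBits-suc n f =
    trans (∑-cartesianProductWith _∷_ (false ∷ true ∷ []) (allBits n) f)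
          (+-congˡ (+-identityʳ _))

  ∑-δ : ∀ n i (f : Bits n → Carrier) → ∑ (allBits n) (λ j → 𝟙[ does (i ≟ᵇ j) ] * f j) ≈ f i
  ∑-δ zero    []          f = trans (+-identityʳ _) (*-identityˡ _)
  -- The comparison reduces on the head bits, so every term in the half with the wrong head is
  -- literally `0# * _`.
  ∑-δ (suc n) (false ∷ i) f = begin
    ∑ (allBits (suc n)) _                                  ≈⟨ ∑-allBits-suc n _ ⟩
    ∑ (allBits n) _ + ∑ (allBits n) _                      ≈⟨ +-congˡ (∑-cong (allBits n) λ _ → zeroˡ _) ⟩
    ∑ (allBits n) _ + ∑ (allBits n) (λ _ → 0#)             ≈⟨ +-cong (∑-δ n i _) (∑-zero (allBits n)) ⟩
    f (false ∷ i) + 0#                                     ≈⟨ +-identityʳ _ ⟩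
    f (false ∷ i)                                          ∎
  ∑-δ (suc n) (true ∷ i)  f = begin
    ∑ (allBits (suc n)) _                                  ≈⟨ ∑-allBits-suc n _ ⟩
    ∑ (allBits n) _ + ∑ (allBits n) _                      ≈⟨ +-congʳ (∑-cong (allBits n) λ _ → zeroˡ _) ⟩
    ∑ (allBits n) (λ _ → 0#) + ∑ (allBits n) _             ≈⟨ +-cong (∑-zero (allBits n)) (∑-δ n i _) ⟩
    0# + f (true ∷ i)                                      ≈⟨ +-identityˡ _ ⟩
    f (true ∷ i)                                           ∎

  ∑-δ′ : ∀ n i (f : Bits n → Carrier) → ∑ (allBits n) (λ j → 𝟙[ does (j ≟ᵇ i) ] * f j) ≈ f i
  ∑-δ′ n i f = trans
    (∑-cong (allBits n) λ j → *-congʳ (reflexive (≡.cong 𝟙[_] (does-⇔ (mk⇔ ≡.sym ≡.sym) (j ≟ᵇ i) (i ≟ᵇ j)))))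
    (∑-δ n i f)

  ∑-const : ∀ n a → ∑ (allBits n) (λ _ → a) ≈ (1# + 1#) ^ n * a
  ∑-const zero    a = trans (+-identityʳ a) (sym (*-identityˡ a))
  ∑-const (suc n) a = begin
    ∑ (allBits (suc n)) (λ _ → a)                            ≈⟨ ∑-allBits-suc n _ ⟩
    ∑ (allBits n) (λ _ → a) + ∑ (allBits n) (λ _ → a)        ≈⟨ +-cong (∑-const n a) (∑-const n a) ⟩
    (1# + 1#) ^ n * a + (1# + 1#) ^ n * a                    ≈⟨ +-cong (*-identityˡ _) (*-identityˡ _) ⟨
    1# * ((1# + 1#) ^ n * a) + 1# * ((1# + 1#) ^ n * a)      ≈⟨ distribʳ _ 1# 1# ⟨
    (1# + 1#) * ((1# + 1#) ^ n * a)                          ≈⟨ *-assoc _ _ _ ⟨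
    (1# + 1#) ^ suc n * a                                    ∎

open import Relation.Binary.PropositionalEquality using (refl; sym; trans; cong; cong₂; module ≡-Reasoning)
open import Data.Rational.Base using (_+_; _*_; _-_; -_; _≤_; *≤*; _/_; ↥_)

private
  ℚ-semiring : CommutativeSemiring 0ℓ 0ℓ
  ℚ-semiring = CommutativeRing.commutativeSemiring ℚ.+-*-commutativeRing

  module Exp = Algebra.Properties.CommutativeSemiring.Exp ℚ-semiring
  module * = Algebra.Properties.CommutativeSemigroup (CommutativeSemiring.*-commutativeSemigroup ℚ-semiring)
  module ⊕ = Algebra.Properties.CommutativeSemigroup (CommutativeRing.+-commutativeSemigroup Bool.xor-∧-commutativeRing)

open FiniteSums ℚ-semiring

2ℚ : ℚ
2ℚ = 1ℚ + 1ℚ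

-- The circuit

ℚ√2-commutativeSemiring : CommutativeSemiring 0ℓ 0ℓ
ℚ√2-commutativeSemiring = record
  { Carrier = ℚ√2
  ; _≈_ = _≡_
  ; _+_ = _+√_
  ; _*_ = _*√_
  ; 0#  = 0√
  ; 1#  = 1√
  ; isCommutativeSemiring = IsCommutativeSemiringˡ.isCommutativeSemiring (record
    { +-isCommutativeMonoid = record
      { isMonoid = record
        { isSemigroup = record
          { isMagma = record { isEquivalence = ≡.isEquivalence ; ∙-cong = cong₂ _+√_ }
          ; assoc = λ (a +√2· b) (c +√2· d) (e +√2· f) →
              cong₂ _+√2·_ (ℚ.+-assoc a c e) (ℚ.+-assoc b d f)
          }
        ; identity = (λ (a +√2· b) → cong₂ _+√2·_ (ℚ.+-identityˡ a) (ℚ.+-identityˡ b))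
                   , (λ (a +√2· b) → cong₂ _+√2·_ (ℚ.+-identityʳ a) (ℚ.+-identityʳ b))
        }
      ; comm = +-comm
      }
    ; *-isCommutativeMonoid = record
      { isMonoid = record
        { isSemigroup = record
          { isMagma = record { isEquivalence = ≡.isEquivalence ; ∙-cong = cong₂ _*√_ }
          ; assoc = *-assoc
          }
        ; identity = *-identityˡ , λ x → trans (*-comm x 1√) (*-identityˡ x)
        }
      ; comm = *-comm
      }
    ; distribʳ = distribʳ
    ; zeroˡ    = zeroˡ
    })
  }
  where
  open +-*-Solver
  +-comm : ∀ x y → x +√ y ≡ y +√ x
  +-comm (a +√2· b) (c +√2· d) = cong₂ _+√2·_ (ℚ.+-comm a c) (ℚ.+-comm b d)
  -- The 2 in the product is passed to the solver as a variable `t`: these identities hold after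
  -- adjoining the square root of any `t`.
  *-comm : ∀ x y → x *√ y ≡ y *√ x
  *-comm (a +√2· b) (c +√2· d) = cong₂ _+√2·_
    (solve 5 (λ a b c d t → a :* c :+ t :* (b :* d) := c :* a :+ t :* (d :* b)) refl a b c d 2ℚ)
    (solve 4 (λ a b c d → a :* d :+ b :* c := c :* b :+ d :* a) refl a b c d)
  *-assoc : ∀ x y z → (x *√ y) *√ z ≡ x *√ (y *√ z)
  *-assoc (a +√2· b) (c +√2· d) (e +√2· f) = cong₂ _+√2·_
    (solve 7 (λ a b c d e f t →
        (a :* c :+ t :* (b :* d)) :* e :+ t :* ((a :* d :+ b :* c) :* f)
      := a :* (c :* e :+ t :* (d :* f)) :+ t :* (b :* (c :* f :+ d :* e))) refl a b c d e f 2ℚ)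
    (solve 7 (λ a b c d e f t →
        (a :* c :+ t :* (b :* d)) :* f :+ (a :* d :+ b :* c) :* e
      := a :* (c :* f :+ d :* e) :+ b :* (c :* e :+ t :* (d :* f))) refl a b c d e f 2ℚ)
  *-identityˡ : ∀ x → 1√ *√ x ≡ x
  *-identityˡ (a +√2· b) = cong₂ _+√2·_
    (solve 3 (λ a b t → con 1ℚ :* a :+ t :* (con 0ℚ :* b) := a) refl a b 2ℚ)
    (solve 2 (λ a b → con 1ℚ :* b :+ con 0ℚ :* a := b) refl a b)
  zeroˡ : ∀ x → 0√ *√ x ≡ 0√
  zeroˡ (a +√2· b) = cong₂ _+√2·_
    (solve 3 (λ a b t → con 0ℚ :* a :+ t :* (con 0ℚ :* b) := con 0ℚ) refl a b 2ℚ)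
    (solve 2 (λ a b → con 0ℚ :* b :+ con 0ℚ :* a := con 0ℚ) refl a b)
  distribʳ : ∀ x y z → (y +√ z) *√ x ≡ y *√ x +√ z *√ x
  distribʳ (a +√2· b) (c +√2· d) (e +√2· f) = cong₂ _+√2·_
    (solve 7 (λ a b c d e f t →
        (c :+ e) :* a :+ t :* ((d :+ f) :* b)
      := (c :* a :+ t :* (d :* b)) :+ (e :* a :+ t :* (f :* b))) refl a b c d e f 2ℚ)
    (solve 6 (λ a b c d e f →
        (c :+ e) :* b :+ (d :+ f) :* a
      := (c :* b :+ d :* a) :+ (e :* b :+ f :* a)) refl a b c d e f)

private
  module √ = CommutativeSemiring ℚ√2-commutativeSemiring
  module √∑ = FiniteSums ℚ√2-commutativeSemiring
  module √* = Algebra.Properties.CommutativeSemigroup √.*-commutativeSemigroup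

open Algebra.Definitions.RawSemiring √.rawSemiring using () renaming (_^_ to _^√_)

fromℚ-* : ∀ a b → fromℚ (a * b) ≡ fromℚ a *√ fromℚ b
fromℚ-* a b = cong₂ _+√2·_
  (sym (ℚ.+-identityʳ (a * b)))
  (sym (trans (cong₂ _+_ (ℚ.*-zeroʳ a) (ℚ.*-zeroˡ b)) (ℚ.+-identityˡ 0ℚ)))

fromℚ-∑ : ∀ (is : List X) f → fromℚ (∑ is f) ≡ √∑.∑ is (λ i → fromℚ (f i))
fromℚ-∑ []       f = refl
fromℚ-∑ (i ∷ is) f = cong (fromℚ (f i) +√_) (fromℚ-∑ is f)

fromℚ-∏ : ∀ (is : Vec X n) f → fromℚ (∏ is f) ≡ √∑.∏ is (λ i → fromℚ (f i))
fromℚ-∏ []       f = refl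
fromℚ-∏ (i ∷ is) f = trans (fromℚ-* (f i) _) (cong (fromℚ (f i) *√_) (fromℚ-∏ is f))

fromℚ-𝟙 : ∀ b → fromℚ (𝟙[ b ]) ≡ √∑.𝟙[ b ]
fromℚ-𝟙 false = refl
fromℚ-𝟙 true  = refl

-- Characters and the Hadamard transform

dot : Bits n → Bits n → Bool
dot []       []       = false
dot (a ∷ as) (b ∷ bs) = (a ∧ b) xor dot as bs

sign : Bool → ℚ
sign false = 1ℚ
sign true  = - 1ℚ

-- The characters of `(ℤ/2)ⁿ`, indexed by `w`.
χ : Bits n → Bits n → ℚ
χ w x = sign (dot w x)

sign-xor : ∀ a b → sign (a xor b) ≡ sign a * sign b
sign-xor false false = refl
sign-xor false true  = refl
sign-xor true  false = refl
sign-xor true  true  = refl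

dot-zeroʳ : ∀ (w : Bits n) → dot w 0ⁿ ≡ false
dot-zeroʳ []      = refl
dot-zeroʳ (a ∷ w) = trans (cong (_xor dot w 0ⁿ) (Bool.∧-zeroʳ a)) (dot-zeroʳ w)

H≡sign : ∀ a b → H a b ≡ 1/√2 *√ fromℚ (sign (a ∧ b))
H≡sign false false = refl
H≡sign false true  = refl
H≡sign true  false = refl
H≡sign true  true  = refl

-- The Hadamard transform is the normalised character table. Splitting off the power of `1/√2`
-- leaves a rational sign.
H^⊗≡χ : ∀ n w x → H^⊗ n w x ≡ (1/√2 ^√ n) *√ fromℚ (χ w x)
H^⊗≡χ zero    []      []      = refl
H^⊗≡χ (suc n) (a ∷ w) (b ∷ x) = begin
  H a b *√ H^⊗ n w x
    ≡⟨ cong₂ _*√_ (H≡sign a b) (H^⊗≡χ n w x) ⟩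
  (1/√2 *√ fromℚ (sign (a ∧ b))) *√ ((1/√2 ^√ n) *√ fromℚ (χ w x))
    ≡⟨ √*.interchange 1/√2 (fromℚ (sign (a ∧ b))) (1/√2 ^√ n) (fromℚ (χ w x)) ⟩
  (1/√2 ^√ suc n) *√ (fromℚ (sign (a ∧ b)) *√ fromℚ (χ w x))
    ≡⟨ cong ((1/√2 ^√ suc n) *√_) (fromℚ-* (sign (a ∧ b)) (χ w x)) ⟨
  (1/√2 ^√ suc n) *√ fromℚ (sign (a ∧ b) * χ w x)
    ≡⟨ cong (λ z → (1/√2 ^√ suc n) *√ fromℚ z) (sign-xor (a ∧ b) (dot w x)) ⟨
  (1/√2 ^√ suc n) *√ fromℚ (χ (a ∷ w) (b ∷ x)) ∎
  where open ≡-Reasoning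

1/√2^n*1/√2^n : ∀ n → (1/√2 ^√ n) *√ (1/√2 ^√ n) ≡ fromℚ (½ ^ℚ n)
1/√2^n*1/√2^n zero    = refl
1/√2^n*1/√2^n (suc n) = begin
  (1/√2 *√ (1/√2 ^√ n)) *√ (1/√2 *√ (1/√2 ^√ n))  ≡⟨ √*.interchange 1/√2 (1/√2 ^√ n) 1/√2 (1/√2 ^√ n) ⟩
  fromℚ ½ *√ ((1/√2 ^√ n) *√ (1/√2 ^√ n))         ≡⟨ cong (fromℚ ½ *√_) (1/√2^n*1/√2^n n) ⟩
  fromℚ ½ *√ fromℚ (½ ^ℚ n)                       ≡⟨ fromℚ-* ½ (½ ^ℚ n) ⟨
  fromℚ (½ ^ℚ suc n)                              ∎
  where open ≡-Reasoning

⊗I-· : ∀ (M : Matrix (Bits n)) (ψ : State n m) w y →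
       ((M ⊗ I m) · ψ) (w , y) ≡ √∑.∑ (allBits n) λ x → M w x *√ ψ (x , y)
⊗I-· {n} {m} M ψ w y = trans
  (√∑.∑-cartesianProductWith _,_ (allBits n) (allBits m) λ j → (M ⊗ I m) (w , y) j *√ ψ j)
  (√∑.∑-cong (allBits n) λ x → trans
    (√∑.∑-cong (allBits m) λ z → begin
      (M w x *√ δ _≟ᵇ_ y z) *√ ψ (x , z)    ≡⟨ cong (_*√ ψ (x , z)) (√.*-comm (M w x) _) ⟩
      (δ _≟ᵇ_ y z *√ M w x) *√ ψ (x , z)    ≡⟨ √.*-assoc (δ _≟ᵇ_ y z) _ _ ⟩
      δ _≟ᵇ_ y z *√ (M w x *√ ψ (x , z))    ∎)
    (√∑.∑-δ m y λ z → M w x *√ ψ (x , z)))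
  where open ≡-Reasoning

δ-× : ∀ (x x′ : Bits n) (y y′ : Bits m) →
      δ _≟ᵇᵇ_ (x , y) (x′ , y′) ≡ δ _≟ᵇ_ x x′ *√ δ _≟ᵇ_ y y′
δ-× x x′ y y′ = trans (cong √∑.𝟙[_] does-≟ᵇᵇ) (√∑.𝟙-∧ (does (x ≟ᵇ x′)) (does (y ≟ᵇ y′)))
  where
  does-≟ᵇᵇ : does ((x , y) ≟ᵇᵇ (x′ , y′)) ≡ does (x ≟ᵇ x′) ∧ does (y ≟ᵇ y′)
  does-≟ᵇᵇ with x ≟ᵇ x′
  ... | yes refl = refl
  ... | no _     = refl

uniformState : ∀ (x : Bits n) (y : Bits m) →
               ((H^⊗ n ⊗ I m) · ∣ 0ⁿ , 0ⁿ ⟩) (x , y) ≡ (1/√2 ^√ n) *√ δ _≟ᵇ_ y 0ⁿ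
uniformState {n} {m} x y = begin
  ((H^⊗ n ⊗ I m) · ∣ 0ⁿ , 0ⁿ ⟩) (x , y)
    ≡⟨ ⊗I-· (H^⊗ n) ∣ 0ⁿ , 0ⁿ ⟩ x y ⟩
  (√∑.∑ (allBits n) λ z → H^⊗ n x z *√ ∣ 0ⁿ , 0ⁿ ⟩ (z , y))
    ≡⟨ (√∑.∑-cong (allBits n) λ z → trans
         (cong (H^⊗ n x z *√_) (δ-× z 0ⁿ y 0ⁿ))
         (√*.x∙yz≈y∙xz (H^⊗ n x z) (δ _≟ᵇ_ z 0ⁿ) (δ _≟ᵇ_ y 0ⁿ))) ⟩
  (√∑.∑ (allBits n) λ z → δ _≟ᵇ_ z 0ⁿ *√ (H^⊗ n x z *√ δ _≟ᵇ_ y 0ⁿ))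
    ≡⟨ √∑.∑-δ′ n 0ⁿ _ ⟩
  H^⊗ n x 0ⁿ *√ δ _≟ᵇ_ y 0ⁿ
    ≡⟨ cong (_*√ δ _≟ᵇ_ y 0ⁿ) (H^⊗≡χ n x 0ⁿ) ⟩
  ((1/√2 ^√ n) *√ fromℚ (χ x 0ⁿ)) *√ δ _≟ᵇ_ y 0ⁿ
    ≡⟨ cong (λ b → ((1/√2 ^√ n) *√ fromℚ (sign b)) *√ δ _≟ᵇ_ y 0ⁿ) (dot-zeroʳ x) ⟩
  ((1/√2 ^√ n) *√ 1√) *√ δ _≟ᵇ_ y 0ⁿ
    ≡⟨ cong (_*√ δ _≟ᵇ_ y 0ⁿ) (√.*-identityʳ (1/√2 ^√ n)) ⟩
  (1/√2 ^√ n) *√ δ _≟ᵇ_ y 0ⁿ ∎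
  where open ≡-Reasoning

-- One δ pins `x′` to `x`, the second register of the input state pins `y′` to `0ⁿ`, and `0ⁿ ⊕ f x`
-- remains.
oracle-· : ∀ (f : Bits n → Bits m) (ψ : State n m) a → (∀ x y → ψ (x , y) ≡ a *√ δ _≟ᵇ_ y 0ⁿ) →
           ∀ x y → (oracle f · ψ) (x , y) ≡ a *√ δ _≟ᵇ_ y (f x)
oracle-· {n} {m} f ψ a ψ≡ x y = begin
  (oracle f · ψ) (x , y)
    ≡⟨ √∑.∑-cartesianProductWith _,_ (allBits n) (allBits m) (λ j → oracle f (x , y) j *√ ψ j) ⟩
  (√∑.∑ (allBits n) λ x′ → √∑.∑ (allBits m) λ y′ → oracle f (x , y) (x′ , y′) *√ ψ (x′ , y′))
    ≡⟨ (√∑.∑-cong (allBits n) λ x′ → trans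
          (√∑.∑-cong (allBits m) λ y′ → trans
            (cong₂ _*√_ (δ-× x x′ y (y′ ⊕ f x′)) (ψ≡ x′ y′))
            (trans (√.*-assoc (δ _≟ᵇ_ x x′) _ _)
                   (cong (δ _≟ᵇ_ x x′ *√_) (√*.x∙yz≈yz∙x (δ _≟ᵇ_ y (y′ ⊕ f x′)) a (δ _≟ᵇ_ y′ 0ⁿ)))))
          (sym (√∑.*-distribˡ-∑ (δ _≟ᵇ_ x x′) (allBits m) _))) ⟩
  (√∑.∑ (allBits n) λ x′ → δ _≟ᵇ_ x x′ *√
     √∑.∑ (allBits m) λ y′ → (a *√ δ _≟ᵇ_ y′ 0ⁿ) *√ δ _≟ᵇ_ y (y′ ⊕ f x′))
    ≡⟨ √∑.∑-δ n x _ ⟩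
  (√∑.∑ (allBits m) λ y′ → (a *√ δ _≟ᵇ_ y′ 0ⁿ) *√ δ _≟ᵇ_ y (y′ ⊕ f x))
    ≡⟨ (√∑.∑-cong (allBits m) λ y′ → √*.xy∙z≈y∙xz a (δ _≟ᵇ_ y′ 0ⁿ) (δ _≟ᵇ_ y (y′ ⊕ f x))) ⟩
  (√∑.∑ (allBits m) λ y′ → δ _≟ᵇ_ y′ 0ⁿ *√ (a *√ δ _≟ᵇ_ y (y′ ⊕ f x)))
    ≡⟨ √∑.∑-δ′ m 0ⁿ _ ⟩
  a *√ δ _≟ᵇ_ y (0ⁿ ⊕ f x)
    ≡⟨ cong (λ z → a *√ δ _≟ᵇ_ y z) (zipWith-identityˡ Bool.xor-identityˡ (f x)) ⟩
  a *√ δ _≟ᵇ_ y (f x) ∎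
  where open ≡-Reasoning

amplitude : (Bits n → Bits m) → Bits n → Bits m → ℚ
amplitude {n} f w y = (½ ^ℚ n) * ∑ (allBits n) λ x → χ w x * 𝟙[ does (y ≟ᵇ f x) ]

simonState≡amplitude : ∀ (f : Bits n → Bits m) w y → simonState f (w , y) ≡ fromℚ (amplitude f w y)
simonState≡amplitude {n} {m} f w y = begin
  simonState f (w , y)
    ≡⟨ ⊗I-· (H^⊗ n) _ w y ⟩
  (√∑.∑ (allBits n) λ x → H^⊗ n w x *√ (oracle f · ((H^⊗ n ⊗ I m) · ∣ 0ⁿ , 0ⁿ ⟩)) (x , y))
    ≡⟨ (√∑.∑-cong (allBits n) λ x → trans
          (cong₂ _*√_ (H^⊗≡χ n w x) (oracle-· f _ (1/√2 ^√ n) uniformState x y))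
          (√*.interchange (1/√2 ^√ n) (fromℚ (χ w x)) (1/√2 ^√ n) (δ _≟ᵇ_ y (f x)))) ⟩
  (√∑.∑ (allBits n) λ x → ((1/√2 ^√ n) *√ (1/√2 ^√ n)) *√ (fromℚ (χ w x) *√ δ _≟ᵇ_ y (f x)))
    ≡⟨ √∑.*-distribˡ-∑ ((1/√2 ^√ n) *√ (1/√2 ^√ n)) (allBits n) _ ⟨
  ((1/√2 ^√ n) *√ (1/√2 ^√ n)) *√ (√∑.∑ (allBits n) λ x → fromℚ (χ w x) *√ δ _≟ᵇ_ y (f x))
    ≡⟨ cong₂ _*√_ (1/√2^n*1/√2^n n) (√∑.∑-cong (allBits n) λ x → trans
          (cong (fromℚ (χ w x) *√_) (sym (fromℚ-𝟙 (does (y ≟ᵇ f x)))))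
          (sym (fromℚ-* (χ w x) _))) ⟩
  fromℚ (½ ^ℚ n) *√ (√∑.∑ (allBits n) λ x → fromℚ (χ w x * 𝟙[ does (y ≟ᵇ f x) ]))
    ≡⟨ cong (fromℚ (½ ^ℚ n) *√_) (fromℚ-∑ (allBits n) λ x → χ w x * 𝟙[ does (y ≟ᵇ f x) ]) ⟨
  fromℚ (½ ^ℚ n) *√ fromℚ (∑ (allBits n) λ x → χ w x * 𝟙[ does (y ≟ᵇ f x) ])
    ≡⟨ fromℚ-* (½ ^ℚ n) _ ⟨
  fromℚ (amplitude f w y) ∎
  where open ≡-Reasoning

outcomeProbability : (Bits n → Bits m) → Bits n → ℚ
outcomeProbability {m = m} f w = ∑ (allBits m) λ y → amplitude f w y * amplitude f w y

simon≡outcomeProbability : ∀ (f : Bits n → Bits m) w → simon f w ≡ fromℚ (outcomeProbability f w)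
simon≡outcomeProbability {n} {m} f w = begin
  simon f w
    ≡⟨ (√∑.∑-cong (allBits m) λ y → trans
          (cong₂ _*√_ (simonState≡amplitude f w y) (simonState≡amplitude f w y))
          (sym (fromℚ-* (amplitude f w y) _))) ⟩
  (√∑.∑ (allBits m) λ y → fromℚ (amplitude f w y * amplitude f w y))
    ≡⟨ fromℚ-∑ (allBits m) (λ y → amplitude f w y * amplitude f w y) ⟨
  fromℚ (outcomeProbability f w) ∎
  where open ≡-Reasoning

-- Powers of 2 and ½

*-mono-≤-nonNeg : ∀ {p q r s} → 0ℚ ≤ q → 0ℚ ≤ r → p ≤ q → r ≤ s → p * r ≤ q * s
*-mono-≤-nonNeg {p} {q} {r} {s} 0≤q 0≤r p≤q r≤s = ℚ.≤-trans
  (ℚ.*-monoʳ-≤-nonNeg r {{ℚ.nonNegative 0≤r}} p≤q)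
  (ℚ.*-monoˡ-≤-nonNeg q {{ℚ.nonNegative 0≤q}} r≤s)

0≤1ℚ : 0ℚ ≤ 1ℚ
0≤1ℚ = ℚ.nonNegative⁻¹ 1ℚ

1≤2ℚ : 1ℚ ≤ 2ℚ
1≤2ℚ = ℚ.+-monoʳ-≤ 1ℚ 0≤1ℚ

1≤2^ : ∀ n → 1ℚ ≤ 2ℚ ^ℚ n
1≤2^ zero    = ℚ.≤-refl
1≤2^ (suc n) = *-mono-≤-nonNeg (ℚ.nonNegative⁻¹ 2ℚ) 0≤1ℚ 1≤2ℚ (1≤2^ n)

0≤2^ : ∀ n → 0ℚ ≤ 2ℚ ^ℚ n
0≤2^ n = ℚ.≤-trans 0≤1ℚ (1≤2^ n)

2^suc : ∀ n → 2ℚ ^ℚ suc n ≡ 2ℚ ^ℚ n + 2ℚ ^ℚ n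
2^suc n = trans (ℚ.*-distribʳ-+ (2ℚ ^ℚ n) 1ℚ 1ℚ) (cong (λ p → p + p) (ℚ.*-identityˡ (2ℚ ^ℚ n)))

1^ : ∀ k → 1ℚ ^ℚ k ≡ 1ℚ
1^ zero    = refl
1^ (suc k) = trans (ℚ.*-identityˡ _) (1^ k)

0≤½^ : ∀ k → 0ℚ ≤ ½ ^ℚ k
0≤½^ zero    = 0≤1ℚ
0≤½^ (suc k) = ℚ.≤-trans (ℚ.≤-reflexive (sym (ℚ.*-zeroʳ ½))) (ℚ.*-monoˡ-≤-nonNeg ½ (0≤½^ k))

-- Fourier analysis of the outcome distribution

⊕-identityˡ : ∀ (x : Bits n) → 0ⁿ ⊕ x ≡ x
⊕-identityˡ = zipWith-identityˡ Bool.xor-identityˡ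

⊕-comm : ∀ (x y : Bits n) → x ⊕ y ≡ y ⊕ x
⊕-comm = zipWith-comm Bool.xor-comm

⊕-self : ∀ (x : Bits n) → x ⊕ x ≡ 0ⁿ
⊕-self []      = refl
⊕-self (a ∷ x) = cong₂ _∷_ (Bool.xor-same a) (⊕-self x)

⊕-cancelʳ : ∀ (x y : Bits n) → (x ⊕ y) ⊕ y ≡ x
⊕-cancelʳ x y = trans (zipWith-assoc Bool.xor-assoc x y y)
  (trans (cong (x ⊕_) (⊕-self y)) (zipWith-identityʳ Bool.xor-identityʳ x))

dot-⊕ : ∀ (w x y : Bits n) → dot w (x ⊕ y) ≡ dot w x xor dot w y
dot-⊕ []      []      []      = refl
dot-⊕ (a ∷ w) (b ∷ x) (c ∷ y) = trans
  (cong₂ _xor_ (Bool.∧-distribˡ-xor a b c) (dot-⊕ w x y))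
  (⊕.interchange (a ∧ b) (a ∧ c) (dot w x) (dot w y))

χ-⊕ : ∀ (w x y : Bits n) → χ w (x ⊕ y) ≡ χ w x * χ w y
χ-⊕ w x y = trans (cong sign (dot-⊕ w x y)) (sign-xor (dot w x) (dot w y))

χ-0ⁿ : ∀ (w : Bits n) → χ w 0ⁿ ≡ 1ℚ
χ-0ⁿ w = cong sign (dot-zeroʳ w)

-- For a new leading bit, the half with `w` starting in 0 repeats the old sum and the other half
-- multiplies it by `sign a * sign b`: the sum doubles if `a` and `b` agree and cancels otherwise.
χ-orthogonal : ∀ n (x y : Bits n) → ∑ (allBits n) (λ w → χ w x * χ w y) ≡ 2ℚ ^ℚ n * 𝟙[ does (x ≟ᵇ y) ]
χ-orthogonal zero    []      []      = refl
χ-orthogonal (suc n) (a ∷ x) (b ∷ y) = begin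
  ∑ (allBits (suc n)) (λ w → χ w (a ∷ x) * χ w (b ∷ y))
    ≡⟨ ∑-allBits-suc n (λ w → χ w (a ∷ x) * χ w (b ∷ y)) ⟩
  ∑ (allBits n) (λ w → χ w x * χ w y) + ∑ (allBits n) (λ w → χ (true ∷ w) (a ∷ x) * χ (true ∷ w) (b ∷ y))
    ≡⟨ cong (∑ (allBits n) (λ w → χ w x * χ w y) +_) (trans
         (∑-cong (allBits n) λ w → trans
           (cong₂ _*_ (sign-xor a (dot w x)) (sign-xor b (dot w y)))
           (*.interchange (sign a) (χ w x) (sign b) (χ w y)))
         (sym (*-distribˡ-∑ (sign a * sign b) (allBits n) (λ w → χ w x * χ w y)))) ⟩
  ∑ (allBits n) (λ w → χ w x * χ w y) + (sign a * sign b) * ∑ (allBits n) (λ w → χ w x * χ w y)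
    ≡⟨ cong (λ s → s + (sign a * sign b) * s) (χ-orthogonal n x y) ⟩
  2ℚ ^ℚ n * 𝟙[ does (x ≟ᵇ y) ] + (sign a * sign b) * (2ℚ ^ℚ n * 𝟙[ does (x ≟ᵇ y) ])
    ≡⟨ head a b ⟩
  2ℚ ^ℚ suc n * 𝟙[ does ((a ∷ x) ≟ᵇ (b ∷ y)) ] ∎
  where
  open ≡-Reasoning
  open +-*-Solver
  double : ∀ p q → p * q + (1ℚ * 1ℚ) * (p * q) ≡ (2ℚ * p) * q
  double = solve 2 (λ p q → p :* q :+ con (1ℚ * 1ℚ) :* (p :* q) := (con 2ℚ :* p) :* q) refl
  vanish : ∀ p q → p * q + (- 1ℚ) * (p * q) ≡ (2ℚ * p) * 0ℚ
  vanish = solve 2 (λ p q → p :* q :+ con (- 1ℚ) :* (p :* q) := (con 2ℚ :* p) :* con 0ℚ) refl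
  head : ∀ a b → 2ℚ ^ℚ n * 𝟙[ does (x ≟ᵇ y) ] + (sign a * sign b) * (2ℚ ^ℚ n * 𝟙[ does (x ≟ᵇ y) ])
                 ≡ 2ℚ ^ℚ suc n * 𝟙[ does ((a ∷ x) ≟ᵇ (b ∷ y)) ]
  head false false = double (2ℚ ^ℚ n) 𝟙[ does (x ≟ᵇ y) ]
  head false true  = vanish (2ℚ ^ℚ n) 𝟙[ does (x ≟ᵇ y) ]
  head true  false = vanish (2ℚ ^ℚ n) 𝟙[ does (x ≟ᵇ y) ]
  head true  true  = double (2ℚ ^ℚ n) 𝟙[ does (x ≟ᵇ y) ]

½^*2^ : ∀ n → ½ ^ℚ n * 2ℚ ^ℚ n ≡ 1ℚ
½^*2^ zero    = refl
½^*2^ (suc n) = trans (*.interchange ½ (½ ^ℚ n) 2ℚ (2ℚ ^ℚ n))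
                      (trans (ℚ.*-identityˡ _) (½^*2^ n))

-- Expanding the square gives pairs `x`, `x′` that must both be mapped to `y`; summing over `y`
-- keeps exactly the pairs with equal values of `f`.
collisions : ∀ (f : Bits n → Bits m) w → outcomeProbability f w ≡
  (½ ^ℚ n * ½ ^ℚ n) * ∑ (allBits n) λ x → ∑ (allBits n) λ x′ →
    (χ w x * χ w x′) * 𝟙[ does (f x ≟ᵇ f x′) ]
collisions {n} {m} f w = begin
  ∑ (allBits m) (λ y → amplitude f w y * amplitude f w y)
    ≡⟨ (∑-cong (allBits m) λ y → trans
         (*.interchange h (A y) h (A y))
         (cong ((h * h) *_) (trans
           (∑-*-∑ (allBits n) (allBits n) (a y) (a y))
           (∑-cong (allBits n) λ x → ∑-cong (allBits n) λ x′ → regroup y x x′)))) ⟩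
  ∑ (allBits m) (λ y → (h * h) * ∑ (allBits n) λ x → ∑ (allBits n) λ x′ → c y x x′)
    ≡⟨ *-distribˡ-∑ (h * h) (allBits m) (λ y → ∑ (allBits n) λ x → ∑ (allBits n) λ x′ → c y x x′) ⟨
  (h * h) * ∑ (allBits m) (λ y → ∑ (allBits n) λ x → ∑ (allBits n) λ x′ → c y x x′)
    ≡⟨ cong ((h * h) *_) (trans
         (∑-comm (allBits m) (allBits n) (λ y x → ∑ (allBits n) λ x′ → c y x x′))
         (∑-cong (allBits n) λ x → trans
           (∑-comm (allBits m) (allBits n) (λ y x′ → c y x x′))
           (∑-cong (allBits n) λ x′ → ∑-δ′ m (f x) (λ y → (χ w x * χ w x′) * 𝟙[ does (y ≟ᵇ f x′) ])))) ⟩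
  (h * h) * ∑ (allBits n) (λ x → ∑ (allBits n) λ x′ → (χ w x * χ w x′) * 𝟙[ does (f x ≟ᵇ f x′) ]) ∎
  where
  open ≡-Reasoning
  h = ½ ^ℚ n
  a : Bits m → Bits n → ℚ
  a y x = χ w x * 𝟙[ does (y ≟ᵇ f x) ]
  A : Bits m → ℚ
  A y = ∑ (allBits n) (a y)
  c : Bits m → Bits n → Bits n → ℚ
  -- The indicator of `y ≟ᵇ f x` comes first so that `∑-δ′` can remove the sum over `y`.
  c y x x′ = 𝟙[ does (y ≟ᵇ f x) ] * ((χ w x * χ w x′) * 𝟙[ does (y ≟ᵇ f x′) ])
  regroup : ∀ y x x′ → a y x * a y x′ ≡ c y x x′
  regroup y x x′ = trans
    (*.interchange (χ w x) 𝟙[ does (y ≟ᵇ f x) ] (χ w x′) 𝟙[ does (y ≟ᵇ f x′) ])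
    (*.x∙yz≈y∙xz (χ w x * χ w x′) 𝟙[ does (y ≟ᵇ f x) ] 𝟙[ does (y ≟ᵇ f x′) ])

-- Simon's promise without naming the subgroup, which is the set of `u` with `f u ≡ f 0ⁿ`; `hidden`
-- decides membership.
HidesSubgroup : (Bits n → Bits m) → Set
HidesSubgroup f = TranslationInvariant λ a b → f a ≡ f b

hidden : (Bits n → Bits m) → Bits n → Bool
hidden f u = does (f u ≟ᵇ f 0ⁿ)

module _ (f : Bits n → Bits m) (invariant : HidesSubgroup f) where

  -- Translation by `x` carries the pair `(x , x ⊕ u)` to `(0ⁿ , u)` and back.
  hidden-shift : ∀ x u → does (f x ≟ᵇ f (x ⊕ u)) ≡ hidden f u
  hidden-shift x u = does-⇔ (mk⇔ to from) (f x ≟ᵇ f (x ⊕ u)) (f u ≟ᵇ f 0ⁿ)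
    where
    to : f x ≡ f (x ⊕ u) → f u ≡ f 0ⁿ
    to e = begin
      f u               ≡⟨ cong f (⊕-cancelʳ u x) ⟨
      f ((u ⊕ x) ⊕ x)   ≡⟨ cong (λ z → f (z ⊕ x)) (⊕-comm u x) ⟩
      f ((x ⊕ u) ⊕ x)   ≡⟨ invariant x e ⟨
      f (x ⊕ x)         ≡⟨ cong f (⊕-self x) ⟩
      f 0ⁿ              ∎
      where open ≡-Reasoning
    from : f u ≡ f 0ⁿ → f x ≡ f (x ⊕ u)
    from e = begin
      f x               ≡⟨ cong f (⊕-identityˡ x) ⟨
      f (0ⁿ ⊕ x)        ≡⟨ invariant x e ⟨
      f (u ⊕ x)         ≡⟨ cong f (⊕-comm u x) ⟩
      f (x ⊕ u)         ∎
      where open ≡-Reasoning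

  -- Multiplying by `χ w u` turns `χ w x` into `χ w (x ⊕ u)`, and orthogonality in `w` leaves only
  -- `x′ = x ⊕ u`. By `hidden-shift` all 2ⁿ remaining collision tests agree; their number and the
  -- factor 2ⁿ from orthogonality cancel `½ⁿ * ½ⁿ`.
  expected-χ : ∀ u → ∑ (allBits n) (λ w → χ w u * outcomeProbability f w) ≡ 𝟙[ hidden f u ]
  expected-χ u = begin
    ∑ (allBits n) (λ w → χ w u * outcomeProbability f w)
      ≡⟨ (∑-cong (allBits n) λ w → trans
           (cong (χ w u *_) (collisions f w))
           (trans (*.x∙yz≈y∙xz (χ w u) (h * h) _) (cong ((h * h) *_) (trans
             (*-distribˡ-∑ (χ w u) (allBits n) _)
             (∑-cong (allBits n) λ x → trans
               (*-distribˡ-∑ (χ w u) (allBits n) _)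
               (∑-cong (allBits n) λ x′ → regroup w x x′)))))) ⟩
    ∑ (allBits n) (λ w → (h * h) * ∑ (allBits n) λ x → ∑ (allBits n) λ x′ → c w x x′)
      ≡⟨ *-distribˡ-∑ (h * h) (allBits n) (λ w → ∑ (allBits n) λ x → ∑ (allBits n) λ x′ → c w x x′) ⟨
    (h * h) * ∑ (allBits n) (λ w → ∑ (allBits n) λ x → ∑ (allBits n) λ x′ → c w x x′)
      ≡⟨ cong ((h * h) *_) (trans
           (∑-comm (allBits n) (allBits n) (λ w x → ∑ (allBits n) λ x′ → c w x x′))
           (∑-cong (allBits n) λ x → trans
             (∑-comm (allBits n) (allBits n) (λ w x′ → c w x x′))
             (trans (∑-cong (allBits n) λ x′ → sumOver-w x x′)
                    (trans (∑-δ n (x ⊕ u) λ x′ → t * 𝟙[ does (f x ≟ᵇ f x′) ])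
                           (cong (λ b → t * 𝟙[ b ]) (hidden-shift x u)))))) ⟩
    (h * h) * ∑ (allBits n) (λ _ → t * 𝟙[ hidden f u ])
      ≡⟨ cong ((h * h) *_) (∑-const n (t * 𝟙[ hidden f u ])) ⟩
    (h * h) * (t * (t * 𝟙[ hidden f u ]))
      ≡⟨ solve 3 (λ h t b → (h :* h) :* (t :* (t :* b)) := ((h :* t) :* (h :* t)) :* b) refl h t 𝟙[ hidden f u ] ⟩
    ((h * t) * (h * t)) * 𝟙[ hidden f u ]
      ≡⟨ cong (λ z → (z * z) * 𝟙[ hidden f u ]) (½^*2^ n) ⟩
    (1ℚ * 1ℚ) * 𝟙[ hidden f u ]
      ≡⟨ ℚ.*-identityˡ 𝟙[ hidden f u ] ⟩
    𝟙[ hidden f u ] ∎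
    where
    open ≡-Reasoning
    open +-*-Solver
    h = ½ ^ℚ n
    t = 2ℚ ^ℚ n
    c : Bits n → Bits n → Bits n → ℚ
    c w x x′ = 𝟙[ does (f x ≟ᵇ f x′) ] * (χ w (x ⊕ u) * χ w x′)
    regroup : ∀ w x x′ → χ w u * ((χ w x * χ w x′) * 𝟙[ does (f x ≟ᵇ f x′) ]) ≡ c w x x′
    regroup w x x′ = trans
      (solve 4 (λ p q r s → p :* ((q :* r) :* s) := s :* ((q :* p) :* r)) refl
         (χ w u) (χ w x) (χ w x′) 𝟙[ does (f x ≟ᵇ f x′) ])
      (cong (λ z → 𝟙[ does (f x ≟ᵇ f x′) ] * (z * χ w x′)) (sym (χ-⊕ w x u)))
    sumOver-w : ∀ x x′ → ∑ (allBits n) (λ w → c w x x′) ≡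
                𝟙[ does ((x ⊕ u) ≟ᵇ x′) ] * (t * 𝟙[ does (f x ≟ᵇ f x′) ])
    sumOver-w x x′ = trans
      (sym (*-distribˡ-∑ 𝟙[ does (f x ≟ᵇ f x′) ] (allBits n) (λ w → χ w (x ⊕ u) * χ w x′)))
      (trans (cong (𝟙[ does (f x ≟ᵇ f x′) ] *_) (χ-orthogonal n (x ⊕ u) x′))
        (solve 3 (λ p q r → p :* (q :* r) := r :* (q :* p)) refl
          𝟙[ does (f x ≟ᵇ f x′) ] t 𝟙[ does ((x ⊕ u) ≟ᵇ x′) ]))

  -- Total mass is the expectation of the trivial character `u = 0ⁿ`.
  totalProbability : ∑ (allBits n) (outcomeProbability f) ≡ 1ℚ
  totalProbability = begin
    ∑ (allBits n) (outcomeProbability f)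
      ≡⟨ (∑-cong (allBits n) λ w → trans (cong (_* outcomeProbability f w) (χ-0ⁿ w)) (ℚ.*-identityˡ (outcomeProbability f w))) ⟨
    ∑ (allBits n) (λ w → χ w 0ⁿ * outcomeProbability f w)
      ≡⟨ expected-χ 0ⁿ ⟩
    𝟙[ hidden f 0ⁿ ]
      ≡⟨ cong 𝟙[_] (dec-true (f 0ⁿ ≟ᵇ f 0ⁿ) refl) ⟩
    1ℚ ∎
    where open ≡-Reasoning

  -- The indicator of `w·u = 0` is `½ * (1ℚ + χ w u)`, so the claim is linear in the two
  -- expectations already known.
  orthogonalProbability : ∀ u → ∑ (allBits n) (λ w → 𝟙[ not (dot w u) ] * outcomeProbability f w) ≡
                                ½ * (1ℚ + 𝟙[ hidden f u ])
  orthogonalProbability u = begin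
    ∑ (allBits n) (λ w → 𝟙[ not (dot w u) ] * p w)
      ≡⟨ (∑-cong (allBits n) λ w → trans (cong (_* p w) (𝟙-not (dot w u)))
           (solve 2 (λ s p → (con ½ :* (con 1ℚ :+ s)) :* p := con ½ :* (p :+ s :* p)) refl (χ w u) (p w))) ⟩
    ∑ (allBits n) (λ w → ½ * (p w + χ w u * p w))
      ≡⟨ *-distribˡ-∑ ½ (allBits n) (λ w → p w + χ w u * p w) ⟨
    ½ * ∑ (allBits n) (λ w → p w + χ w u * p w)
      ≡⟨ cong (½ *_) (trans (∑-distrib-+ (allBits n) p (λ w → χ w u * p w)) (cong₂ _+_ totalProbability (expected-χ u))) ⟩
    ½ * (1ℚ + 𝟙[ hidden f u ]) ∎
    where
    open ≡-Reasoning
    open +-*-Solver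
    p = outcomeProbability f
    𝟙-not : ∀ b → 𝟙[ not b ] ≡ ½ * (1ℚ + sign b)
    𝟙-not false = refl
    𝟙-not true  = refl

-- Union bound

∑-nonNeg : ∀ (is : List X) {f} → (∀ i → 0ℚ ≤ f i) → 0ℚ ≤ ∑ is f
∑-nonNeg []       h = ℚ.≤-refl
∑-nonNeg (i ∷ is) h = ℚ.+-mono-≤ (h i) (∑-nonNeg is h)

∑-mono-≤ : ∀ (is : List X) {f g} → (∀ i → f i ≤ g i) → ∑ is f ≤ ∑ is g
∑-mono-≤ []       h = ℚ.≤-refl
∑-mono-≤ (i ∷ is) h = ℚ.+-mono-≤ (h i) (∑-mono-≤ is h)

∏-nonNeg : ∀ (is : Vec X n) {f} → (∀ i → 0ℚ ≤ f i) → 0ℚ ≤ ∏ is f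
∏-nonNeg []       h = 0≤1ℚ
∏-nonNeg (i ∷ is) {f} h = ℚ.≤-trans (ℚ.≤-reflexive (sym (ℚ.*-zeroʳ (f i))))
  (ℚ.*-monoˡ-≤-nonNeg (f i) {{ℚ.nonNegative (h i)}} (∏-nonNeg is h))

𝟙-nonNeg : ∀ b → 0ℚ ≤ 𝟙[ b ]
𝟙-nonNeg false = ℚ.≤-refl
𝟙-nonNeg true  = 0≤1ℚ

p*p-nonNeg : ∀ p → 0ℚ ≤ p * p
p*p-nonNeg p with ℚ.≤-total 0ℚ p
... | inj₁ 0≤p = ℚ.≤-trans (ℚ.≤-reflexive (sym (ℚ.*-zeroʳ p))) (ℚ.*-monoˡ-≤-nonNeg p {{ℚ.nonNegative 0≤p}} 0≤p)
... | inj₂ p≤0 = ℚ.≤-trans (ℚ.≤-reflexive (sym (ℚ.*-zeroʳ p))) (ℚ.*-monoˡ-≤-nonPos p {{ℚ.nonPositive p≤0}} p≤0)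

outcomeProbability-nonNeg : ∀ (f : Bits n → Bits m) w → 0ℚ ≤ outcomeProbability f w
outcomeProbability-nonNeg {m = m} f w = ∑-nonNeg (allBits m) λ y → p*p-nonNeg (amplitude f w y)

-- The union bound at a single sample point: either no bad event occurs, or the sum counts at least
-- one.
1≤𝟙-all+∑ : ∀ (is : List X) (g : X → Bool) → 1ℚ ≤ 𝟙[ all (λ i → not (g i)) is ] + ∑ is (λ i → 𝟙[ g i ])
1≤𝟙-all+∑ []       g = ℚ.≤-refl
1≤𝟙-all+∑ (i ∷ is) g with g i
... | false = ℚ.≤-trans (1≤𝟙-all+∑ is g)
                (ℚ.+-monoʳ-≤ 𝟙[ all (λ i → not (g i)) is ] (ℚ.≤-reflexive (sym (ℚ.+-identityˡ _))))
... | true  = ℚ.≤-trans (ℚ.+-monoʳ-≤ 1ℚ (∑-nonNeg is λ i → 𝟙-nonNeg (g i)))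
                (ℚ.≤-reflexive (sym (ℚ.+-identityˡ _)))

orthogonal : ∀ {k} → Vec (Bits n) k → Bits n → Bool
orthogonal []      u = true
orthogonal (w ∷ ω) u = not (dot w u) ∧ orthogonal ω u

𝟙-orthogonal : ∀ {k} (ω : Vec (Bits n) k) u → 𝟙[ orthogonal ω u ] ≡ ∏ ω λ w → 𝟙[ not (dot w u) ]
𝟙-orthogonal []      u = refl
𝟙-orthogonal (w ∷ ω) u = trans (𝟙-∧ (not (dot w u)) (orthogonal ω u))
                               (cong (𝟙[ not (dot w u) ] *_) (𝟙-orthogonal ω u))

misjudged : (Bits n → Bits m) → Bits n → Vec (Bits n) k → Bool
misjudged f u ω = orthogonal ω u xor hidden f u

success : (Bits n → Bits m) → Vec (Bits n) k → Bool
success {n} f ω = all (λ u → not (misjudged f u ω)) (allBits n)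

successProbability : (Bits n → Bits m) → ℕ → ℚ
successProbability {n} f k =
  ∑ (allVecs (allBits n) k) λ ω → 𝟙[ success f ω ] * ∏ ω (outcomeProbability f)

module _ (f : Bits n → Bits m) (invariant : HidesSubgroup f) (k : ℕ) where
  private
    Ω : List (Vec (Bits n) k)
    Ω = allVecs (allBits n) k

    μ : Vec (Bits n) k → ℚ
    μ ω = ∏ ω (outcomeProbability f)

    ∑μ : ∑ Ω μ ≡ 1ℚ
    ∑μ = trans (∑-∏ (allBits n) k (outcomeProbability f))
           (trans (cong (_^ℚ k) (totalProbability f invariant)) (1^ k))

  allOrthogonalProbability : ∀ u → ∑ Ω (λ ω → 𝟙[ orthogonal ω u ] * μ ω) ≡
                                   (½ * (1ℚ + 𝟙[ hidden f u ])) ^ℚ k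
  allOrthogonalProbability u = trans
    (∑-cong Ω λ ω → trans (cong (_* μ ω) (𝟙-orthogonal ω u))
      (sym (∏-distrib-* ω (λ w → 𝟙[ not (dot w u) ]) (outcomeProbability f))))
    (trans (∑-∏ (allBits n) k λ w → 𝟙[ not (dot w u) ] * outcomeProbability f w)
      (cong (_^ℚ k) (orthogonalProbability f invariant u)))

  -- The error is one-sided. A hidden `u` is orthogonal to all outcomes with probability 1, so its
  -- rejection has mass 0; any other `u` passes all `k` independent tests with probability exactly
  -- `½ ^ℚ k`.
  misjudgedProbability : ∀ u → ∑ Ω (λ ω → 𝟙[ misjudged f u ω ] * μ ω) ≤ ½ ^ℚ k
  misjudgedProbability u = bound (hidden f u) (allOrthogonalProbability u)
    where
    split : ∀ b p → 𝟙[ b xor true ] * p + 𝟙[ b ] * p ≡ p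
    split true  p = trans (cong₂ _+_ (ℚ.*-zeroˡ p) (ℚ.*-identityˡ p)) (ℚ.+-identityˡ p)
    split false p = trans (cong₂ _+_ (ℚ.*-identityˡ p) (ℚ.*-zeroˡ p)) (ℚ.+-identityʳ p)
    rejected accepted : ℚ
    rejected = ∑ Ω (λ ω → 𝟙[ orthogonal ω u xor true ] * μ ω)
    accepted = ∑ Ω (λ ω → 𝟙[ orthogonal ω u ] * μ ω)
    vanishes : accepted ≡ 1ℚ ^ℚ k → rejected ≡ 0ℚ
    vanishes e = AbelianGroup.∙-cancelʳ 1ℚ rejected 0ℚ (begin
      rejected + 1ℚ
        ≡⟨ cong (rejected +_) (trans e (1^ k)) ⟨
      rejected + accepted
        ≡⟨ ∑-distrib-+ Ω (λ ω → 𝟙[ orthogonal ω u xor true ] * μ ω) (λ ω → 𝟙[ orthogonal ω u ] * μ ω) ⟨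
      ∑ Ω (λ ω → 𝟙[ orthogonal ω u xor true ] * μ ω + 𝟙[ orthogonal ω u ] * μ ω)
        ≡⟨ (∑-cong Ω λ ω → split (orthogonal ω u) (μ ω)) ⟩
      ∑ Ω μ
        ≡⟨ ∑μ ⟩
      1ℚ
        ≡⟨ ℚ.+-identityˡ 1ℚ ⟨
      0ℚ + 1ℚ ∎)
      where
      open ≡-Reasoning
      module AbelianGroup = Algebra.Properties.AbelianGroup ℚ.+-0-abelianGroup
    -- With `hidden f u` abstracted to `h`, matching on `h` makes `½ * (1ℚ + 𝟙[ h ])` evaluate to
    -- `½` or `1ℚ`.
    bound : ∀ h → ∑ Ω (λ ω → 𝟙[ orthogonal ω u ] * μ ω) ≡ (½ * (1ℚ + 𝟙[ h ])) ^ℚ k →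
            ∑ Ω (λ ω → 𝟙[ orthogonal ω u xor h ] * μ ω) ≤ ½ ^ℚ k
    bound false e = ℚ.≤-reflexive (trans
          (∑-cong Ω λ ω → cong (λ b → 𝟙[ b ] * μ ω) (Bool.xor-identityʳ (orthogonal ω u))) e)
    bound true  e = ℚ.≤-trans (ℚ.≤-reflexive (vanishes e)) (0≤½^ k)

  -- The pointwise union bound is integrated against `μ`; exchanging the sums leaves one
  -- misjudgement probability for each of the 2ⁿ vectors.
  1≤successProbability+2^n*½^k : 1ℚ ≤ successProbability f k + 2ℚ ^ℚ n * ½ ^ℚ k
  1≤successProbability+2^n*½^k = begin
    1ℚ
      ≡⟨ ∑μ ⟨
    ∑ Ω μ
      ≡⟨ (∑-cong Ω λ ω → ℚ.*-identityˡ (μ ω)) ⟨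
    ∑ Ω (λ ω → 1ℚ * μ ω)
      ≤⟨ (∑-mono-≤ Ω λ ω → ℚ.*-monoʳ-≤-nonNeg (μ ω)
           {{ℚ.nonNegative (∏-nonNeg ω (outcomeProbability-nonNeg f))}}
           (1≤𝟙-all+∑ (allBits n) λ u → misjudged f u ω)) ⟩
    ∑ Ω (λ ω → (𝟙[ success f ω ] + ∑ (allBits n) λ u → 𝟙[ misjudged f u ω ]) * μ ω)
      ≡⟨ (∑-cong Ω λ ω → trans
           (ℚ.*-distribʳ-+ (μ ω) 𝟙[ success f ω ] (∑ (allBits n) λ u → 𝟙[ misjudged f u ω ]))
           (cong (𝟙[ success f ω ] * μ ω +_) (*-distribʳ-∑ (μ ω) (allBits n) λ u → 𝟙[ misjudged f u ω ]))) ⟩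
    ∑ Ω (λ ω → 𝟙[ success f ω ] * μ ω + ∑ (allBits n) λ u → 𝟙[ misjudged f u ω ] * μ ω)
      ≡⟨ ∑-distrib-+ Ω (λ ω → 𝟙[ success f ω ] * μ ω) (λ ω → ∑ (allBits n) λ u → 𝟙[ misjudged f u ω ] * μ ω) ⟩
    successProbability f k + ∑ Ω (λ ω → ∑ (allBits n) λ u → 𝟙[ misjudged f u ω ] * μ ω)
      ≡⟨ cong (successProbability f k +_) (∑-comm Ω (allBits n) λ ω u → 𝟙[ misjudged f u ω ] * μ ω) ⟩
    successProbability f k + ∑ (allBits n) (λ u → ∑ Ω λ ω → 𝟙[ misjudged f u ω ] * μ ω)
      ≤⟨ ℚ.+-monoʳ-≤ (successProbability f k) (∑-mono-≤ (allBits n) misjudgedProbability) ⟩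
    successProbability f k + ∑ (allBits n) (λ _ → ½ ^ℚ k)
      ≡⟨ cong (successProbability f k +_) (∑-const n (½ ^ℚ k)) ⟩
    successProbability f k + 2ℚ ^ℚ n * ½ ^ℚ k ∎
    where open ℚ.≤-Reasoning

-- Number of iterations

-- Built with `mkℚ` so that numerator and denominator are visible without evaluating a gcd.
fromℕ : ℕ → ℚ
fromℕ n = mkℚ (pos n) 0 (Coprimality.sym (1-coprimeTo n))

1+fromℕ : ∀ n → 1ℚ + fromℕ n ≡ fromℕ (suc n)
1+fromℕ n = trans (cong (λ i → i / 1) (cong (ℤ._+_ (pos 1)) (ℤ.*-identityʳ (pos n)))) (ℚ.↥p/↧p≡p (fromℕ (suc n)))

fromℕ≤2^ : ∀ n → fromℕ n ≤ 2ℚ ^ℚ n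
fromℕ≤2^ zero    = 0≤1ℚ
fromℕ≤2^ (suc n) = begin
  fromℕ (suc n)              ≡⟨ 1+fromℕ n ⟨
  1ℚ + fromℕ n               ≤⟨ ℚ.+-mono-≤ (1≤2^ n) (fromℕ≤2^ n) ⟩
  2ℚ ^ℚ n + 2ℚ ^ℚ n          ≡⟨ 2^suc n ⟨
  2ℚ ^ℚ suc n                ∎
  where open ℚ.≤-Reasoning

≤fromℕ : ∀ τ → τ ≤ fromℕ ℤ.∣ ↥ τ ∣
≤fromℕ (mkℚ (pos p) d _)  = *≤* (ℤ.≤-trans (ℤ.≤-reflexive (ℤ.*-identityʳ (pos p)))
                                 (ℤ.≤-trans (ℤ.+≤+ (ℕ.m≤m*n p (suc d))) (ℤ.≤-reflexive (ℤ.pos-* p (suc d)))))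
≤fromℕ (mkℚ -[1+ p ] d _) = *≤* ℤ.-≤+

-- Downward search by structural recursion; if `τ ≤ 2ℚ ^ℚ N`, it stops at the least exponent whose
-- power of 2 is at least `τ`.
lgBelow : ℕ → ℚ → ℕ
lgBelow zero    τ = 0
lgBelow (suc N) τ with τ ℚ.≤? 2ℚ ^ℚ N
... | yes _ = lgBelow N τ
... | no  _ = suc N

-- The factor 2 is the cost of rounding up: the search stops at `suc N` only because `2ℚ ^ℚ N` is
-- below `τ`. At exponent 0 the upper bound comes from `1ℚ ≤ τ`.
lgBelow-bounds : ∀ N τ → 1ℚ ≤ τ → τ ≤ 2ℚ ^ℚ N →
                 τ ≤ 2ℚ ^ℚ lgBelow N τ × 2ℚ ^ℚ lgBelow N τ ≤ 2ℚ * τ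
lgBelow-bounds zero    τ 1≤τ τ≤2^ = τ≤2^ , *-mono-≤-nonNeg (ℚ.nonNegative⁻¹ 2ℚ) 0≤1ℚ 1≤2ℚ 1≤τ
lgBelow-bounds (suc N) τ 1≤τ τ≤2^ with τ ℚ.≤? 2ℚ ^ℚ N
... | yes τ≤2^N = lgBelow-bounds N τ 1≤τ τ≤2^N
... | no  τ≰2^N = τ≤2^ , ℚ.*-monoˡ-≤-nonNeg 2ℚ (ℚ.<⇒≤ (ℚ.≰⇒> τ≰2^N))

-- The starting exponent ∣ ↥ τ ∣ is large enough because τ ≤ ∣ ↥ τ ∣ ≤ 2 ^ ∣ ↥ τ ∣.
⌈lg_⌉ : ℚ → ℕ
⌈lg τ ⌉ = lgBelow ℤ.∣ ↥ τ ∣ τ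

⌈lg⌉-bounds : ∀ τ → 1ℚ ≤ τ → τ ≤ 2ℚ ^ℚ ⌈lg τ ⌉ × 2ℚ ^ℚ ⌈lg τ ⌉ ≤ 2ℚ * τ
⌈lg⌉-bounds τ 1≤τ = lgBelow-bounds ℤ.∣ ↥ τ ∣ τ 1≤τ (ℚ.≤-trans (≤fromℕ τ) (fromℕ≤2^ ℤ.∣ ↥ τ ∣))

iterations : ℕ → ℚ → ℕ
iterations n τ = n ℕ.+ ⌈lg τ ⌉

2^iterations : ∀ n τ → 2ℚ ^ℚ iterations n τ ≡ 2ℚ ^ℚ n * 2ℚ ^ℚ ⌈lg τ ⌉
2^iterations n τ = Exp.^-homo-* 2ℚ n ⌈lg τ ⌉

2^n*τ≤2^iterations : ∀ n τ → 1ℚ ≤ τ → 2ℚ ^ℚ n * τ ≤ 2ℚ ^ℚ iterations n τ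
2^n*τ≤2^iterations n τ 1≤τ = begin
  2ℚ ^ℚ n * τ                 ≤⟨ ℚ.*-monoˡ-≤-nonNeg (2ℚ ^ℚ n) {{ℚ.nonNegative (0≤2^ n)}} (proj₁ (⌈lg⌉-bounds τ 1≤τ)) ⟩
  2ℚ ^ℚ n * 2ℚ ^ℚ ⌈lg τ ⌉     ≡⟨ 2^iterations n τ ⟨
  2ℚ ^ℚ iterations n τ        ∎
  where open ℚ.≤-Reasoning

iterations-Θ : Θ[n+lgτ] iterations
-- `c = 2` absorbs the rounding factor 2, which is at most 2ⁿ because `n` is at least 1. `d = 1`
-- suffices because the logarithm is rounded up.
iterations-Θ = 2 , 1 , λ n τ 1≤n 1≤τ →
  upper n τ 1≤n 1≤τ ,
  ℚ.≤-trans (2^n*τ≤2^iterations n τ 1≤τ) (ℚ.≤-reflexive (sym (ℚ.*-identityʳ _)))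
  where
  open ℚ.≤-Reasoning
  upper : ∀ n τ → 1 ℕ.≤ n → 1ℚ ≤ τ → 2ℚ ^ℚ iterations n τ ≤ (2ℚ ^ℚ n * τ) ^ℚ 2
  upper n@(suc n-1) τ _ 1≤τ = begin
    2ℚ ^ℚ iterations n τ               ≡⟨ 2^iterations n τ ⟩
    2ℚ ^ℚ n * 2ℚ ^ℚ ⌈lg τ ⌉            ≤⟨ ℚ.*-monoˡ-≤-nonNeg (2ℚ ^ℚ n) {{ℚ.nonNegative (0≤2^ n)}} (proj₂ (⌈lg⌉-bounds τ 1≤τ)) ⟩
    2ℚ ^ℚ n * (2ℚ * τ)                 ≤⟨ *-mono-≤-nonNeg (ℚ.≤-trans 0≤1ℚ 1≤2^n*τ) 0≤2τ 2^n≤ 2τ≤ ⟩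
    (2ℚ ^ℚ n * τ) * (2ℚ ^ℚ n * τ)      ≡⟨ cong ((2ℚ ^ℚ n * τ) *_) (ℚ.*-identityʳ (2ℚ ^ℚ n * τ)) ⟨
    (2ℚ ^ℚ n * τ) ^ℚ 2                 ∎
    where
    0≤τ = ℚ.≤-trans 0≤1ℚ 1≤τ
    2^n≤ : 2ℚ ^ℚ n ≤ 2ℚ ^ℚ n * τ
    2^n≤ = ℚ.≤-trans (ℚ.≤-reflexive (sym (ℚ.*-identityʳ _))) (ℚ.*-monoˡ-≤-nonNeg (2ℚ ^ℚ n) {{ℚ.nonNegative (0≤2^ n)}} 1≤τ)
    1≤2^n*τ = ℚ.≤-trans (1≤2^ n) 2^n≤
    2≤2^n : 2ℚ ≤ 2ℚ ^ℚ n
    2≤2^n = ℚ.*-monoˡ-≤-nonNeg 2ℚ (1≤2^ n-1)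
    2τ≤ : 2ℚ * τ ≤ 2ℚ ^ℚ n * τ
    2τ≤ = ℚ.*-monoʳ-≤-nonNeg τ {{ℚ.nonNegative 0≤τ}} 2≤2^n
    0≤2τ : 0ℚ ≤ 2ℚ * τ
    0≤2τ = ℚ.≤-trans (ℚ.≤-reflexive (sym (ℚ.*-zeroʳ 2ℚ))) (ℚ.*-monoˡ-≤-nonNeg 2ℚ 0≤τ)

-- Multiplied by `τ`, the left side is at most `2ℚ ^ℚ K * ½ ^ℚ K`, which is 1.
2^n*½^iterations≤1/τ : ∀ n τ .{{_ : NonZero τ}} → 1ℚ ≤ τ → 2ℚ ^ℚ n * ½ ^ℚ iterations n τ ≤ 1/ τ
2^n*½^iterations≤1/τ n τ 1≤τ = ℚ.*-cancelʳ-≤-pos τ {{ℚ.positive (ℚ.<-≤-trans (ℚ.positive⁻¹ 1ℚ) 1≤τ)}} (begin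
  (2ℚ ^ℚ n * ½ ^ℚ K) * τ       ≡⟨ ℚ.*-assoc (2ℚ ^ℚ n) _ _ ⟩
  2ℚ ^ℚ n * (½ ^ℚ K * τ)       ≡⟨ cong (2ℚ ^ℚ n *_) (ℚ.*-comm _ τ) ⟩
  2ℚ ^ℚ n * (τ * ½ ^ℚ K)       ≡⟨ ℚ.*-assoc (2ℚ ^ℚ n) _ _ ⟨
  (2ℚ ^ℚ n * τ) * ½ ^ℚ K       ≤⟨ ℚ.*-monoʳ-≤-nonNeg (½ ^ℚ K) {{ℚ.nonNegative (0≤½^ K)}} (2^n*τ≤2^iterations n τ 1≤τ) ⟩
  2ℚ ^ℚ K * ½ ^ℚ K             ≡⟨ Exp.^-distrib-* 2ℚ ½ K ⟨
  1ℚ ^ℚ K                      ≡⟨ 1^ K ⟩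
  1ℚ                           ≡⟨ ℚ.*-inverseˡ τ ⟨
  1/ τ * τ                     ∎)
  where
  open ℚ.≤-Reasoning
  K = iterations n τ

-- Post-processing

∈-allBits : ∀ (v : Bits n) → v ∈ allBits n
∈-allBits []      = here refl
∈-allBits (b ∷ v) = ∈-cartesianProductWith⁺ _∷_ (∈-bits b) (∈-allBits v)
  where
  ∈-bits : ∀ b → b ∈ (false ∷ true ∷ [])
  ∈-bits false = here refl
  ∈-bits true  = there (here refl)

-- The whole orthogonal complement of the outcomes is listed, rather than a basis, so that each pair
-- of the kernel is a translate of one generator.
generators : Vec (Bits n) k → List (Bits n × Bits n)
generators {n} ω = List.map (_, 0ⁿ) (filterᵇ (orthogonal ω) (allBits n))

∈-generators⁺ : ∀ (ω : Vec (Bits n) k) u → T (orthogonal ω u) → (u , 0ⁿ) ∈ generators ω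
∈-generators⁺ ω u h = ∈-map⁺ (_, 0ⁿ) (∈-filter⁺ (λ v → Bool.T? (orthogonal ω v)) (∈-allBits u) h)

∈-generators⁻ : ∀ (ω : Vec (Bits n) k) {a b} → (a , b) ∈ generators ω → T (orthogonal ω a) × b ≡ 0ⁿ
∈-generators⁻ {n} ω p with ∈-map⁻ (_, 0ⁿ) p
... | u , u∈ , refl with ∈-filter⁻ (λ v → Bool.T? (orthogonal ω v)) {xs = allBits n} u∈
... | _ , h = h , refl

T-does⇒ : ∀ {P : Set} (P? : Dec P) → T (does P?) → P
T-does⇒ (yes p) _ = p

success⇒orthogonal≡hidden : ∀ (f : Bits n → Bits m) (ω : Vec (Bits n) k) → T (success f ω) →
                            ∀ u → orthogonal ω u ≡ hidden f u
success⇒orthogonal≡hidden f ω s u =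
  agree (orthogonal ω u) (hidden f u) (All.lookup (All.all⁺ _ (allBits _) s) (∈-allBits u))
  where
  agree : ∀ b h → T (not (b xor h)) → b ≡ h
  agree false false _ = refl
  agree true  true  _ = refl

-- Moves the success probability from `ℚ√2` to `ℚ`, where the union bound is proved.
simon-success : ∀ (f : Bits n → Bits m) k →
  √∑.∑ (allVecs (allBits n) k) (λ ω → if success f ω then √∑.∏ ω (simon f) else 0√) ≡
  fromℚ (successProbability f k)
simon-success {n} f k = trans
  (√∑.∑-cong (allVecs (allBits n) k) λ ω → trans
    (cong (λ p → if success f ω then p else 0√) (trans
      (√∑.∏-cong ω (simon≡outcomeProbability f))
      (sym (fromℚ-∏ ω (outcomeProbability f)))))
    (fromℚ-if (success f ω) (∏ ω (outcomeProbability f))))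
  (sym (fromℚ-∑ (allVecs (allBits n) k) λ ω → 𝟙[ success f ω ] * ∏ ω (outcomeProbability f)))
  where
  fromℚ-if : ∀ b p → (if b then fromℚ p else 0√) ≡ fromℚ (𝟙[ b ] * p)
  fromℚ-if false p = cong fromℚ (sym (ℚ.*-zeroˡ p))
  fromℚ-if true  p = cong fromℚ (sym (ℚ.*-identityˡ p))

fromℚ-mono-≤ : ∀ {p q} → p ≤ q → fromℚ p ≤√ fromℚ q
fromℚ-mono-≤ {p} p≤q = inj₁
  (ℚ.≤-trans (ℚ.≤-reflexive (sym (ℚ.+-inverseʳ p))) (ℚ.+-monoˡ-≤ (- p) p≤q) , ℚ.≤-refl)

p≤q+r∧r≤s⇒p-s≤q : ∀ {p q r s} → p ≤ q + r → r ≤ s → p - s ≤ q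
p≤q+r∧r≤s⇒p-s≤q {p} {q} {r} {s} p≤q+r r≤s = begin
  p - s          ≤⟨ ℚ.+-monoˡ-≤ (- s) (ℚ.≤-trans p≤q+r (ℚ.+-monoʳ-≤ q r≤s)) ⟩
  (q + s) - s    ≡⟨ ℚ.+-assoc q s (- s) ⟩
  q + (s - s)    ≡⟨ cong (q +_) (ℚ.+-inverseʳ s) ⟩
  q + 0ℚ         ≡⟨ ℚ.+-identityʳ q ⟩
  q              ∎
  where open ℚ.≤-Reasoning

-- The hidden kernel problem for powers of two-element algebras

theorem4p1 : ∀ {σ : Signature} (B : Algebra σ Bool) →
    (MPT₀∞ ≼ B) ⊎ (MPT₁∞ ≼ B) ⊎ (AP ≼ B) →
    Σ[ iterations ∈ (ℕ → ℚ → ℕ) ]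
    Σ[ post ∈ (∀ n τ → PostProcessing n (iterations n τ)) ]
    Θ[n+lgτ] iterations ×
    (∀ n (τ : ℚ) .{{_ : NonZero τ}} → 1ℚ ℚ.≤ τ →
    SolvesHKP (B ^ᴬ n) (iterations n τ) (post n τ) (1ℚ ℚ.- 1/ τ))
theorem4p1 B clones = iterations , (λ _ _ → generators) , iterations-Θ , solves
  where
  solves : ∀ n (τ : ℚ) .{{_ : NonZero τ}} → 1ℚ ℚ.≤ τ →
           SolvesHKP (B ^ᴬ n) (iterations n τ) generators (1ℚ ℚ.- 1/ τ)
  solves n τ 1≤τ C φ hom encode faithful =
    success f , correct ,
    subst (fromℚ (1ℚ ℚ.- 1/ τ) ≤√_) (sym (simon-success f K))
      (fromℚ-mono-≤ {q = successProbability f K}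
        (p≤q+r∧r≤s⇒p-s≤q {q = successProbability f K}
          (1≤successProbability+2^n*½^k f invariant K) (2^n*½^iterations≤1/τ n τ 1≤τ)))
    where
    K = iterations n τ
    f = λ x → encode (φ x)
    ker-invariant : TranslationInvariant (λ a b → φ a ≡ φ b)
    ker-invariant = congruence⇒translationInvariant (ker-isCongruence {A = B ^ᴬ n} {C} hom) clones
    invariant : HidesSubgroup f
    -- Equal codes come from equal values of `φ`, so the invariance of the kernel passes to the
    -- encoded function that the circuit queries.
    invariant c {a} {b} e = cong encode (ker-invariant c (faithful a b e))
    correct : ∀ ω → T (success f ω) → GeneratesKernel (B ^ᴬ n) (generators ω) φ
    correct ω s a b = mk⇔
      (Cg-least (ker-isCongruence {C = C} hom) generator⊆ker)
      -- The generator `(a ⊕ b , 0ⁿ)` translated by `b` is `(a , b)`; the translation is legitimate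
      -- because the generated relation is itself a congruence.
      λ φa≡φb → subst₂ (Cg (B ^ᴬ n) (generators ω)) (⊕-cancelʳ a b) (⊕-identityˡ b)
        (congruence⇒translationInvariant (Cg-isCongruence (B ^ᴬ n) (generators ω)) clones b
          (Cg.base (∈-generators⁺ ω (a ⊕ b) (difference φa≡φb))))
      where
      orthogonal≡hidden = success⇒orthogonal≡hidden f ω s
      generator⊆ker : ∀ {a b} → (a , b) ∈ generators ω → φ a ≡ φ b
      generator⊆ker {a} p with ∈-generators⁻ ω p
      ... | h , refl = faithful a 0ⁿ (T-does⇒ (f a ≟ᵇ f 0ⁿ) (subst T (orthogonal≡hidden a) h))
      difference : φ a ≡ φ b → T (orthogonal ω (a ⊕ b))
      -- Translating `φ a ≡ φ b` by `b` gives `φ (a ⊕ b) ≡ φ 0ⁿ`, so `a ⊕ b` is hidden and hence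
      -- orthogonal to all outcomes.
      difference e = subst T (sym (trans (orthogonal≡hidden (a ⊕ b))
        (dec-true (f (a ⊕ b) ≟ᵇ f 0ⁿ)
          (cong encode (trans (ker-invariant b e) (cong φ (⊕-self b))))))) tt
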